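{- For all integers $m,n\ge 2$, $$\mathrm{BSR}(m,n)\ \ge\ z_{wA}(m,n)\ \ge\ z_{wL}(m,n)\ \ge\ z_L(m,n)\ \ge\ z(m,n).$$
   Context: Notation: $[m]=\{1,\dots,m\}$. An $m\times n$ biquadratic form is a real polynomial $P(\mathbf{x},\mathbf{y})=\sum_{i,k=1}^m\sum_{j,l=1}^n a_{ijkl}x_ix_ky_jy_l$ (with $a_{ijkl}=a_{kjil}=a_{klij}$). It is SOS if $P=\sum_{p=1}^r f_p^2$ with each $f_p$ a real bilinear form in $(\mathbf{x},\mathbf{y})$; the minimum such $r$ is its SOS rank $\mathrm{SOS}(P)$. $\mathrm{BSR}(m,n)$ is the maximum SOS rank among all $m\times n$ SOS biquadratic forms. $z(m,n)$ (the Zarankiewicz number) is the maximum number of edges of an $m\times n$ bipartite graph with no $C_4$. Augmented bipartite graphs $G=(S,T,E_1\cup E_2)$, $S=[m]$, $T=[n]$. A cell is a pair $(i,j)\in[m]\times[n]$ ($i$ is its row, $j$ its column). A 1-edge is a cell; $E_1$ is a set of 1-edges, viewed as a bipartite graph $G_1$ on $S,T$. A 2-edge is an unordered pair of distinct cells, written $(i,j;k,l)$; the cells $(i,j)$ and $(k,l)$ are its two halves. It is nondegenerate if $i\ne k$ and $j\ne l$, row-degenerate if $i=k$ and $j\neq l$, column-degenerate if $i\ne k$ and $j=l$. $E_2$ is a set of 2-edges. A cell is occupied if it is in $E_1$ or is a half of some 2-edge in $E_2$; otherwise it is unoccupied. The opposite cells of a nondegenerate 2-edge $(i,j;k,l)$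 are $(i,l)$ and $(k,j)$. Two nondegenerate 2-edges of the form $(i,j;k,l)$ and $(i,l;k,j)$ are called complementary. The dependency graph $\mathcal{D}$ is the directed graph whose vertices are the nondegenerate 2-edges in $E_2$, with an arc $e\to e'$ ($e\ne e'$) if both opposite cells of $e$ are occupied and one half of $e'$ is an opposite cell of $e$. An edge's row (column) set is the set of rows (columns) of its cell (1-edge) or of its halves (2-edge). Two edges are vertex-disjoint if their row sets are disjoint and their column sets are disjoint. The opposite cells of a vertex-disjoint pair $e,f$ are the cells formed by a row of one of the two edges and a column of the other. For a 1-edge $(i,j)$ and a 2-edge $(k,l;p,q)$ they are $(i,l),(i,q),(k,j),(p,j)$. Conditions: (S) No 2-edge shares a cell with any 1-edge or with any other 2-edge. (W1) $G_1$ contains no $C_4$. (W2) $\mathcal{D}$ contains no directed cycle other than 2-cycles formed by a pair of complementary 2-edges (which are allowed). (W2') There is no nondegenerate 2-edge in $E_2$ whose two opposite cells are both 1-edges. (W3) For every vertex-disjoint pair of edges of $G$ at least one of which is a 2-edge, at least one of the opposite cells of the pair is unoccupied. $z_{wA}(m,n)$ is the maximum of $|E_1|+|E_2|$ over all $G$ satisfying (S), (W1), (W2), (W2'), (W3). $z_{wL}(m,n)$ is the maximum of $|E_1|+|E_2|$ over those such $G$ that in addition satisfy $|E_1|=z(m,n)$. $z_L(m,n)$ (the limited augmented Zarankiewicz number) is the maximum of $|E_1|+|E_2|$ over all $G$ with $|E_1|=z(m,n)$ satisfying (S), (W1), and the two original conditions: (Condition 2) no nondegenerate 2-edge in $E_2$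 has both of its opposite cells occupied; (Condition 3) there are no 2-edge $(i,j;p,q)\in E_2$ and cell $(k,l)$ with $k\notin\{i,p\}$, $l\notin\{j,q\}$ such that all of the cells $(k,l),(k,j),(k,q),(i,l),(p,l)$ are occupied. -}

module Defs where

open import Data.Nat as ℕ using (ℕ; _≤_; _⊔_)
import Data.Nat.Properties as ℕ
open import Data.Fin as Fin using (Fin)
open import Data.Rational as ℚ using (ℚ; 0ℚ; 1ℚ; ½; ∣_∣; 1/_; Positive)
import Data.Rational.Properties as ℚ
open import Data.Rational.Solver using (module +-*-Solver)
open import Data.List using (List; []; _∷_; [_]; _++_; length; map; cartesianProduct)
open import Data.List.Membership.Propositional using (_∈_; _∉_)
open import Data.List.Relation.Binary.Disjoint.Propositional using (Disjoint)
open import Data.List.Relation.Unary.Any using (Any)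
open import Data.List.Relation.Unary.Linked using (Linked)
open import Data.List.Relation.Unary.Unique.Propositional using (Unique)
open import Data.Product using (∃; ∃-syntax; _×_; _,_; proj₁; proj₂)
open import Data.Product.Relation.Binary.Lex.Strict using (×-Lex)
open import Data.Sum using (_⊎_; inj₁; inj₂)
open import Data.Vec.Functional using (foldr)
open import Relation.Nullary using (¬_)
open import Relation.Binary.PropositionalEquality
  using (_≡_; _≢_; refl; sym; trans; cong; cong₂; subst)

-- Cauchy sequences of rationals, up to the setoid equality _≈_
-- ("the difference tends to 0"); all operations are termwise.

dist : ℚ → ℚ → ℚ
dist p q = ∣ p ℚ.- q ∣

IsCauchy : (ℕ → ℚ) → Set
IsCauchy x = ∀ ε → 0ℚ ℚ.< ε → ∃[ N ] ∀ i j → N ≤ i → N ≤ j → dist (x i) (x j) ℚ.< ε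

record ℝ : Set where
  constructor mkℝ
  field
    seq    : ℕ → ℚ
    cauchy : IsCauchy seq

open ℝ public

infix 4 _≈_

record _≈_ (x y : ℝ) : Set where
  constructor mk≈
  field
    difference→0 : ∀ ε → 0ℚ ℚ.< ε → ∃[ N ] ∀ i → N ≤ i → dist (seq x i) (seq y i) ℚ.< ε

private
  open +-*-Solver
  open ℚ.≤-Reasoning

  abstract
    half-pos : ∀ {ε} → 0ℚ ℚ.< ε → 0ℚ ℚ.< ½ ℚ.* ε
    half-pos {ε} ε>0 = subst (ℚ._< ½ ℚ.* ε) (ℚ.*-zeroʳ ½) (ℚ.*-monoʳ-<-pos ½ ε>0)

    halves-sum : ∀ ε → ½ ℚ.* ε ℚ.+ ½ ℚ.* ε ≡ ε
    halves-sum ε = trans (sym (ℚ.*-distribʳ-+ ε ½ ½)) (ℚ.*-identityˡ ε)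

    const-cauchy : ∀ q → IsCauchy (λ _ → q)
    const-cauchy q ε ε>0 = 0 , λ _ _ _ _ →
      subst (λ d → ∣ d ∣ ℚ.< ε) (sym (ℚ.+-inverseʳ q)) ε>0

    dist-+ : ∀ a b c d → dist (a ℚ.+ b) (c ℚ.+ d) ℚ.≤ dist a c ℚ.+ dist b d
    dist-+ a b c d = begin
      ∣ (a ℚ.+ b) ℚ.- (c ℚ.+ d) ∣    ≡⟨ cong ∣_∣ (solve 4 (λ a b c d →
        (a :+ b) :- (c :+ d) := (a :- c) :+ (b :- d)) refl a b c d) ⟩
      ∣ (a ℚ.- c) ℚ.+ (b ℚ.- d) ∣    ≤⟨ ℚ.∣p+q∣≤∣p∣+∣q∣ (a ℚ.- c) (b ℚ.- d) ⟩
      dist a c ℚ.+ dist b d          ∎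

    +-cauchy : ∀ {x y} → IsCauchy x → IsCauchy y → IsCauchy (λ k → x k ℚ.+ y k)
    +-cauchy {x} {y} cx cy ε ε>0 with cx (½ ℚ.* ε) (half-pos ε>0) | cy (½ ℚ.* ε) (half-pos ε>0)
    ... | M , hx | N , hy = M ⊔ N , λ i j i≥ j≥ → begin-strict
      dist (x i ℚ.+ y i) (x j ℚ.+ y j)
        ≤⟨ dist-+ (x i) (y i) (x j) (y j) ⟩
      dist (x i) (x j) ℚ.+ dist (y i) (y j)
        <⟨ ℚ.+-mono-< (hx i j (ℕ.m⊔n≤o⇒m≤o M N i≥) (ℕ.m⊔n≤o⇒m≤o M N j≥))
                      (hy i j (ℕ.m⊔n≤o⇒n≤o M N i≥) (ℕ.m⊔n≤o⇒n≤o M N j≥)) ⟩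
      ½ ℚ.* ε ℚ.+ ½ ℚ.* ε
        ≡⟨ halves-sum ε ⟩
      ε ∎

    cauchy⇒bounded : ∀ {x} → IsCauchy x →
                     ∃[ B ] ∃[ N ] Positive B × (∀ i → N ≤ i → ∣ x i ∣ ℚ.≤ B)
    cauchy⇒bounded {x} cx with cx 1ℚ (ℚ.positive⁻¹ 1ℚ)
    ... | N , h = 1ℚ ℚ.+ ∣ x N ∣ , N
                , ℚ.positive (ℚ.+-mono-<-≤ (ℚ.positive⁻¹ 1ℚ) (ℚ.0≤∣p∣ (x N)))
                , λ i i≥N → begin
        ∣ x i ∣                      ≡⟨ cong ∣_∣ (solve 2 (λ a b →
          a := (a :- b) :+ b) refl (x i) (x N)) ⟩
        ∣ (x i ℚ.- x N) ℚ.+ x N ∣    ≤⟨ ℚ.∣p+q∣≤∣p∣+∣q∣ (x i ℚ.- x N) (x N) ⟩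
        dist (x i) (x N) ℚ.+ ∣ x N ∣ ≤⟨ ℚ.+-monoˡ-≤ ∣ x N ∣ (ℚ.<⇒≤ (h i N i≥N ℕ.≤-refl)) ⟩
        1ℚ ℚ.+ ∣ x N ∣               ∎

    dist-* : ∀ a b c d →
             dist (a ℚ.* b) (c ℚ.* d) ℚ.≤ ∣ a ∣ ℚ.* dist b d ℚ.+ ∣ d ∣ ℚ.* dist a c
    dist-* a b c d = begin
      ∣ a ℚ.* b ℚ.- c ℚ.* d ∣
        ≡⟨ cong ∣_∣ (solve 4 (λ a b c d →
             a :* b :- c :* d := a :* (b :- d) :+ d :* (a :- c)) refl a b c d) ⟩
      ∣ a ℚ.* (b ℚ.- d) ℚ.+ d ℚ.* (a ℚ.- c) ∣
        ≤⟨ ℚ.∣p+q∣≤∣p∣+∣q∣ (a ℚ.* (b ℚ.- d)) (d ℚ.* (a ℚ.- c)) ⟩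
      ∣ a ℚ.* (b ℚ.- d) ∣ ℚ.+ ∣ d ℚ.* (a ℚ.- c) ∣
        ≡⟨ cong₂ ℚ._+_ (ℚ.∣p*q∣≡∣p∣*∣q∣ a (b ℚ.- d)) (ℚ.∣p*q∣≡∣p∣*∣q∣ d (a ℚ.- c)) ⟩
      ∣ a ∣ ℚ.* dist b d ℚ.+ ∣ d ∣ ℚ.* dist a c ∎

    *-bound-< : ∀ {p B q δ} → Positive B → p ℚ.≤ B → 0ℚ ℚ.≤ q → q ℚ.< δ →
                p ℚ.* q ℚ.< B ℚ.* δ
    *-bound-< {p} {B} {q} {δ} B>0 p≤B q≥0 q<δ = begin-strict
      p ℚ.* q ≤⟨ ℚ.*-monoʳ-≤-nonNeg q {{ℚ.nonNegative q≥0}} p≤B ⟩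
      B ℚ.* q <⟨ ℚ.*-monoʳ-<-pos B {{B>0}} q<δ ⟩
      B ℚ.* δ ∎

    scale : ∀ B {ε} → Positive B → 0ℚ ℚ.< ε → ∃[ δ ] (0ℚ ℚ.< δ) × B ℚ.* δ ≡ ε
    scale B {ε} B>0 ε>0 = C ℚ.* ε
      , subst (ℚ._< C ℚ.* ε) (ℚ.*-zeroʳ C) (ℚ.*-monoʳ-<-pos C {{ℚ.1/pos⇒pos B {{B>0}}}} ε>0)
      , trans (sym (ℚ.*-assoc B C ε))
              (trans (cong (ℚ._* ε) (ℚ.*-inverseʳ B {{B≢0}})) (ℚ.*-identityˡ ε))
      where
      B≢0 : ℚ.NonZero B
      B≢0 = ℚ.pos⇒nonZero B {{B>0}}
      C : ℚ
      C = (1/ B) {{B≢0}}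

    dist-*-< : ∀ {A B a b c d δ} → Positive A → Positive B → ∣ a ∣ ℚ.≤ A → ∣ d ∣ ℚ.≤ B →
               dist a c ℚ.< δ → dist b d ℚ.< δ → dist (a ℚ.* b) (c ℚ.* d) ℚ.< (A ℚ.+ B) ℚ.* δ
    dist-*-< {A} {B} {a} {b} {c} {d} {δ} A>0 B>0 a≤A d≤B ac<δ bd<δ = begin-strict
      dist (a ℚ.* b) (c ℚ.* d)                   ≤⟨ dist-* a b c d ⟩
      ∣ a ∣ ℚ.* dist b d ℚ.+ ∣ d ∣ ℚ.* dist a c  <⟨ ℚ.+-mono-< {∣ a ∣ ℚ.* dist b d} {A ℚ.* δ}
        (*-bound-< {B = A} A>0 a≤A (ℚ.0≤∣p∣ (b ℚ.- d)) bd<δ)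
        (*-bound-< {B = B} B>0 d≤B (ℚ.0≤∣p∣ (a ℚ.- c)) ac<δ) ⟩
      A ℚ.* δ ℚ.+ B ℚ.* δ                        ≡⟨ sym (ℚ.*-distribʳ-+ δ A B) ⟩
      (A ℚ.+ B) ℚ.* δ                            ∎

    *-cauchy : ∀ {x y} → IsCauchy x → IsCauchy y → IsCauchy (λ k → x k ℚ.* y k)
    *-cauchy {x} {y} cx cy ε ε>0 =
      let (A , K , A>0 , bx) = cauchy⇒bounded cx
          (B , L , B>0 , by) = cauchy⇒bounded cy
          (δ , δ>0 , eq) = scale (A ℚ.+ B) (ℚ.pos+pos⇒pos A {{A>0}} B {{B>0}}) ε>0
          (M , hx) = cx δ δ>0
          (N , hy) = cy δ δ>0
      in combine A B δ K L M N A>0 B>0 eq bx by hx hy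
      where
      combine : ∀ A B δ K L M N → Positive A → Positive B → (A ℚ.+ B) ℚ.* δ ≡ ε →
                (∀ i → K ≤ i → ∣ x i ∣ ℚ.≤ A) → (∀ i → L ≤ i → ∣ y i ∣ ℚ.≤ B) →
                (∀ i j → M ≤ i → M ≤ j → dist (x i) (x j) ℚ.< δ) →
                (∀ i j → N ≤ i → N ≤ j → dist (y i) (y j) ℚ.< δ) →
                ∃[ N′ ] ∀ i j → N′ ≤ i → N′ ≤ j → dist (x i ℚ.* y i) (x j ℚ.* y j) ℚ.< ε
      combine A B δ K L M N A>0 B>0 eq bx by hx hy = (K ⊔ L) ⊔ (M ⊔ N) , λ i j i≥ j≥ →
        let i≥KL = ℕ.m⊔n≤o⇒m≤o (K ⊔ L) (M ⊔ N) i≥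
            j≥KL = ℕ.m⊔n≤o⇒m≤o (K ⊔ L) (M ⊔ N) j≥
            i≥MN = ℕ.m⊔n≤o⇒n≤o (K ⊔ L) (M ⊔ N) i≥
            j≥MN = ℕ.m⊔n≤o⇒n≤o (K ⊔ L) (M ⊔ N) j≥
        in subst (dist (x i ℚ.* y i) (x j ℚ.* y j) ℚ.<_) eq
             (dist-*-< {A} {B} A>0 B>0
               (bx i (ℕ.m⊔n≤o⇒m≤o K L i≥KL)) (by j (ℕ.m⊔n≤o⇒n≤o K L j≥KL))
               (hx i j (ℕ.m⊔n≤o⇒m≤o M N i≥MN) (ℕ.m⊔n≤o⇒m≤o M N j≥MN))
               (hy i j (ℕ.m⊔n≤o⇒n≤o M N i≥MN) (ℕ.m⊔n≤o⇒n≤o M N j≥MN)))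

infixl 6 _+ℝ_
infixl 7 _*ℝ_

fromℚ : ℚ → ℝ
fromℚ q = mkℝ (λ _ → q) (const-cauchy q)

0ℝ : ℝ
0ℝ = fromℚ 0ℚ

_+ℝ_ : ℝ → ℝ → ℝ
x +ℝ y = mkℝ (λ k → seq x k ℚ.+ seq y k) (+-cauchy {seq x} {seq y} (cauchy x) (cauchy y))

_*ℝ_ : ℝ → ℝ → ℝ
x *ℝ y = mkℝ (λ k → seq x k ℚ.* seq y k) (*-cauchy {seq x} {seq y} (cauchy x) (cauchy y))

∑ : ∀ {k} → (Fin k → ℝ) → ℝ
∑ = foldr _+ℝ_ 0ℝ

BilinearForm : ℕ → ℕ → Set
BilinearForm m n = Fin m → Fin n → ℝ

evalBilinear : ∀ {m n} → BilinearForm m n → (Fin m → ℝ) → (Fin n → ℝ) → ℝ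
evalBilinear b x y = ∑ λ i → ∑ λ j → b i j *ℝ x i *ℝ y j

record BiquadraticForm (m n : ℕ) : Set where
  field
    coeff : Fin m → Fin n → Fin m → Fin n → ℝ
    sym₁  : ∀ i j k l → coeff i j k l ≈ coeff k j i l
    sym₂  : ∀ i j k l → coeff i j k l ≈ coeff k l i j

evalBiquadratic : ∀ {m n} → BiquadraticForm m n → (Fin m → ℝ) → (Fin n → ℝ) → ℝ
evalBiquadratic P x y =
  ∑ λ i → ∑ λ k → ∑ λ j → ∑ λ l → coeff i j k l *ℝ x i *ℝ x k *ℝ y j *ℝ y l
  where open BiquadraticForm P

-- Real polynomials are identified with the functions they induce, which
-- is harmless since ℝ is infinite.
IsSumOfSquares : ∀ {m n} → BiquadraticForm m n → ℕ → Set
IsSumOfSquares {m} {n} P r =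
  ∃ λ (f : Fin r → BilinearForm m n) → ∀ x y →
    evalBiquadratic P x y ≈ ∑ λ p → evalBilinear (f p) x y *ℝ evalBilinear (f p) x y

IsMinimum IsMaximum : (ℕ → Set) → ℕ → Set
IsMinimum Q k = Q k × (∀ l → Q l → k ≤ l)
IsMaximum Q k = Q k × (∀ l → Q l → l ≤ k)

-- Inhabited for some r exactly when P is SOS.
IsSOSRank : ∀ {m n} → BiquadraticForm m n → ℕ → Set
IsSOSRank P = IsMinimum (IsSumOfSquares P)

IsBSR : ℕ → ℕ → ℕ → Set
IsBSR m n = IsMaximum λ r → ∃[ P ] IsSOSRank {m} {n} P r

-- A 1-edge is a cell.  Finite sets are duplicate-free lists.
Cell : ℕ → ℕ → Set
Cell m n = Fin m × Fin n

module _ {m n : ℕ} where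

  row : Cell m n → Fin m
  row = proj₁

  col : Cell m n → Fin n
  col = proj₂

  C₄-Free : List (Cell m n) → Set
  C₄-Free E = ∀ {i k j l} → i ≢ k → j ≢ l →
              ¬ ((i , j) ∈ E × (i , l) ∈ E × (k , j) ∈ E × (k , l) ∈ E)

IsZarankiewicz : ℕ → ℕ → ℕ → Set
IsZarankiewicz m n = IsMaximum λ k →
  ∃[ E ] Unique {A = Cell m n} E × C₄-Free E × length E ≡ k

_<ₗₑₓ_ : ∀ {m n} → Cell m n → Cell m n → Set
_<ₗₑₓ_ = ×-Lex _≡_ Fin._<_ Fin._<_

-- An unordered pair of distinct cells is stored as its unique
-- lexicographically increasing ordering; as the proof of this is
-- irrelevant, _≡_ is equality of unordered pairs.
record TwoEdge (m n : ℕ) : Set where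
  constructor twoEdge
  field
    half₁ half₂ : Cell m n
    .increasing : half₁ <ₗₑₓ half₂

open TwoEdge public using (half₁; half₂)

module _ {m n : ℕ} where

  IsHalf : Cell m n → TwoEdge m n → Set
  IsHalf c e = c ≡ half₁ e ⊎ c ≡ half₂ e

  Nondegenerate : TwoEdge m n → Set
  Nondegenerate e = row (half₁ e) ≢ row (half₂ e) × col (half₁ e) ≢ col (half₂ e)

  -- The opposite cells (i,l) and (k,j) of (i,j;k,l).
  opp₁ opp₂ : TwoEdge m n → Cell m n
  opp₁ e = row (half₁ e) , col (half₂ e)
  opp₂ e = row (half₂ e) , col (half₁ e)

  -- For nondegenerate e the cells opp₁ e and opp₂ e are distinct, so they
  -- are exactly the two halves of f.
  Complementary : TwoEdge m n → TwoEdge m n → Set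
  Complementary e f = Nondegenerate e × Nondegenerate f
                    × IsHalf (opp₁ e) f × IsHalf (opp₂ e) f

record AugmentedGraph (m n : ℕ) : Set where
  field
    E₁        : List (Cell m n)
    E₂        : List (TwoEdge m n)
    E₁-unique : Unique E₁
    E₂-unique : Unique E₂

module _ {m n : ℕ} where

  data Edge : Set where
    one : Cell m n → Edge
    two : TwoEdge m n → Edge

  cells : Edge → List (Cell m n)
  cells (one c) = [ c ]
  cells (two e) = half₁ e ∷ half₂ e ∷ []

  rows : Edge → List (Fin m)
  rows e = map row (cells e)

  cols : Edge → List (Fin n)
  cols e = map col (cells e)

  VertexDisjoint : Edge → Edge → Set
  VertexDisjoint e f = Disjoint (rows e) (rows f) × Disjoint (cols e) (cols f)

  oppositeCells : Edge → Edge → List (Cell m n)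
  oppositeCells e f = cartesianProduct (rows e) (cols f) ++ cartesianProduct (rows f) (cols e)

  data IsTwoEdge : Edge → Set where
    two : ∀ e → IsTwoEdge (two e)

  module _ (G : AugmentedGraph m n) where
    open AugmentedGraph G

    size : ℕ
    size = length E₁ ℕ.+ length E₂

    Occupied : Cell m n → Set
    Occupied c = c ∈ E₁ ⊎ ∃[ e ] e ∈ E₂ × IsHalf c e

    data IsEdge : Edge → Set where
      one : ∀ {c} → c ∈ E₁ → IsEdge (one c)
      two : ∀ {e} → e ∈ E₂ → IsEdge (two e)

    IsVertex : TwoEdge m n → Set
    IsVertex e = e ∈ E₂ × Nondegenerate e

    Arc : TwoEdge m n → TwoEdge m n → Set
    Arc e e′ = IsVertex e × IsVertex e′ × e ≢ e′
             × Occupied (opp₁ e) × Occupied (opp₂ e)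
             × (IsHalf (opp₁ e) e′ ⊎ IsHalf (opp₂ e) e′)

    -- e → e₁ → ⋯ → eₖ → e with e, e₁, …, eₖ distinct.
    IsDirectedCycle : TwoEdge m n → List (TwoEdge m n) → Set
    IsDirectedCycle e es = Unique (e ∷ es) × Linked Arc (e ∷ es ++ [ e ])

    CondS : Set
    CondS = (∀ {c e} → e ∈ E₂ → IsHalf c e → c ∉ E₁)
          × (∀ {c e f} → e ∈ E₂ → f ∈ E₂ → e ≢ f → IsHalf c e → ¬ IsHalf c f)

    CondW1 : Set
    CondW1 = C₄-Free E₁

    CondW2 : Set
    CondW2 = ∀ e es → IsDirectedCycle e es → ∃[ f ] es ≡ [ f ] × Complementary e f

    CondW2′ : Set
    CondW2′ = ∀ {e} → e ∈ E₂ → Nondegenerate e → ¬ (opp₁ e ∈ E₁ × opp₂ e ∈ E₁)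

    CondW3 : Set
    CondW3 = ∀ {e f} → IsEdge e → IsEdge f → IsTwoEdge e ⊎ IsTwoEdge f →
             VertexDisjoint e f → Any (λ c → ¬ Occupied c) (oppositeCells e f)

    Cond2 : Set
    Cond2 = ∀ {e} → e ∈ E₂ → Nondegenerate e → ¬ (Occupied (opp₁ e) × Occupied (opp₂ e))

    Cond3 : Set
    Cond3 = ∀ {e} → e ∈ E₂ → ∀ k l →
            let (i , j) = half₁ e
                (p , q) = half₂ e
            in k ≢ i → k ≢ p → l ≢ j → l ≢ q →
               ¬ (Occupied (k , l) × Occupied (k , j) × Occupied (k , q)
                  × Occupied (i , l) × Occupied (p , l))

    WeaklyAdmissible : Set
    WeaklyAdmissible = CondS × CondW1 × CondW2 × CondW2′ × CondW3

    Limited : Set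
    Limited = IsZarankiewicz m n (length E₁)

IsZwA : ℕ → ℕ → ℕ → Set
IsZwA m n = IsMaximum λ k →
  ∃[ G ] WeaklyAdmissible {m} {n} G × size G ≡ k

IsZwL : ℕ → ℕ → ℕ → Set
IsZwL m n = IsMaximum λ k →
  ∃[ G ] WeaklyAdmissible {m} {n} G × Limited G × size G ≡ k

IsZL : ℕ → ℕ → ℕ → Set
IsZL m n = IsMaximum λ k →
  ∃[ G ] CondS {m} {n} G × CondW1 G × Cond2 G × Cond3 G × Limited G × size G ≡ k

{-# OPTIONS --safe #-}
module Submission where

-- For the first inequality, a weakly admissible G is turned into the form P = Σₑ (Σ_{(i,j)∈e} xᵢyⱼ)².
-- If P is also the sum of the squares of l bilinear forms, let v c ∈ ℝˡ collect their coefficients at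
-- the cell c.  Polarising P determines ⟨v(i,j),v(k,l)⟩ + ⟨v(i,l),v(k,j)⟩ for all i, j, k, l.  Hence v
-- vanishes on unoccupied cells and has norm 1 on occupied ones, and the conditions on G force v to be
-- constant on each 2-edge (by well-founded induction along the dependency graph, which (W2) makes
-- acyclic away from complementary pairs) and orthogonal on distinct edges.  Thus ℝˡ contains as many
-- orthonormal vectors as G has edges.
--
-- Only ring identities and "a vanishing sum of squares has vanishing terms" are used, so that no order
-- or apartness on the constructive reals is needed.

open import Algebra.Bundles using (CommutativeRing)
import Algebra.Properties.Group
import Algebra.Properties.Monoid.Mult
import Algebra.Properties.Semiring.Sum
import Algebra.Solver.Ring.NaturalCoefficients.Default
open import Data.Bool using (if_then_else_)
open import Data.Empty using (⊥-elim)
open import Data.Fin as Fin using (Fin; zero; suc)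
import Data.Fin.Properties as Fin
open import Data.List using (List; []; _∷_; [_]; _++_; length; map; lookup; cartesianProduct)
open import Data.List.Properties using (length-++; length-map; ++-assoc)
import Data.List.Membership.DecPropositional as DecMembership
open import Data.List.Membership.Propositional using (_∈_; _∉_; find; lose)
open import Data.List.Membership.Propositional.Properties
  using (∈-map⁺; ∈-map⁻; ∈-++⁺ˡ; ∈-++⁺ʳ; ∈-++⁻; ∈-∃++; ∈-lookup; ∈-cartesianProduct⁺; ∈-cartesianProduct⁻)
open import Data.List.Relation.Unary.All as All using ([]; _∷_)
open import Data.List.Relation.Unary.AllPairs using ([]; _∷_)
open import Data.List.Relation.Unary.Any as Any using (Any; here; there)
open import Data.List.Relation.Unary.Any.Properties using (lookup-index)
open import Data.List.Relation.Unary.Linked as Linked using (Linked; [-]; _∷_)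
open import Data.List.Relation.Unary.Unique.Propositional using (Unique)
import Data.List.Relation.Unary.Unique.Propositional.Properties as Unique
open import Data.Nat as ℕ using (ℕ; zero; suc; _≤_; _≥_)
import Data.Nat.Properties as ℕ
open import Data.Product using (∃-syntax; _×_; _,_; proj₁; proj₂; swap)
open import Data.Product.Properties using (≡-dec)
open import Data.Rational as ℚ using (ℚ; 0ℚ; 1ℚ; ½; ∣_∣; 1/_; Positive)
import Data.Rational.Properties as ℚ
open import Data.Rational.Solver using (module +-*-Solver)
open import Data.Sum as Sum using (_⊎_; inj₁; inj₂)
open import Function using (_∘_; flip)
open import Induction.WellFounded using (WellFounded; Acc; acc)
open import Level as Level using (Level; 0ℓ)
open import Relation.Binary.Definitions using (DecidableEquality)
open import Relation.Binary.PropositionalEquality as ≡ using (_≡_; _≢_; _≗_; refl; cong; cong₂)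
import Relation.Binary.Reasoning.Setoid
open import Relation.Nullary using (¬_; Dec; yes; no; does; contradiction; map′)
open import Relation.Nullary.Decidable using (¬?; _×-dec_; _⊎-dec_)
open import Defs hiding (_≈_)

-- Inner products of vectors over a commutative ring.

module BilinearAlgebra {c ℓ : Level} (R : CommutativeRing c ℓ) where
  open CommutativeRing R hiding (zero) renaming (refl to ≈-refl)
  open Algebra.Properties.Semiring.Sum semiring public
    using (sum; sum-cong-≋; sum-replicate; sum-replicate-zero; ∑-distrib-+; ∑-comm; *-distribˡ-sum; *-distribʳ-sum)
  open Algebra.Properties.Monoid.Mult +-monoid using () renaming (_×_ to _·_; ×-homo-+ to ·-homo-+)
  open Algebra.Properties.Group +-group using () renaming (∙-cancelʳ to +-cancelʳ; ∙-cancelˡ to +-cancelˡ)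
  open Algebra.Solver.Ring.NaturalCoefficients.Default commutativeSemiring using (solve; _:=_; _:+_; _:*_; con)
  open Relation.Binary.Reasoning.Setoid setoid

  Vector : ℕ → Set c
  Vector r = Fin r → Carrier

  Matrix : ℕ → ℕ → Set c
  Matrix m n = Fin m → Vector n

  infix 5 _≐_
  _≐_ : ∀ {r} → Vector r → Vector r → Set ℓ
  u ≐ v = ∀ p → u p ≈ v p

  ⟨_,_⟩ : ∀ {r} → Vector r → Vector r → Carrier
  ⟨ u , v ⟩ = sum λ p → u p * v p

  ∥_∥² : ∀ {r} → Vector r → Carrier
  ∥ u ∥² = ⟨ u , u ⟩

  ⟨⟩-cong : ∀ {r} {u u′ v v′ : Vector r} → u ≐ u′ → v ≐ v′ → ⟨ u , v ⟩ ≈ ⟨ u′ , v′ ⟩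
  ⟨⟩-cong u≐u′ v≐v′ = sum-cong-≋ λ p → *-cong (u≐u′ p) (v≐v′ p)

  ⟨⟩-comm : ∀ {r} (u v : Vector r) → ⟨ u , v ⟩ ≈ ⟨ v , u ⟩
  ⟨⟩-comm u v = sum-cong-≋ λ p → *-comm (u p) (v p)

  ⟨⟩-zeroˡ : ∀ {r} {u : Vector r} → (∀ p → u p ≈ 0#) → ∀ v → ⟨ u , v ⟩ ≈ 0#
  ⟨⟩-zeroˡ {r} u≐0 v = trans
    (sum-cong-≋ λ p → trans (*-congʳ (u≐0 p)) (zeroˡ (v p)))
    (sum-replicate-zero r)

  sum-*-sum : ∀ {r s} (u : Vector r) (v : Vector s) →
              sum u * sum v ≈ sum λ p → sum λ q → u p * v q
  sum-*-sum u v = trans (*-distribʳ-sum (sum v) u) (sum-cong-≋ λ p → *-distribˡ-sum (u p) v)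

  -- The cross terms stand on the left so that, after the substitution `a ≈ e + b`, both sides are
  -- free of subtraction and fall to the semiring solver.
  square-difference : ∀ a b → (a - b) * (a - b) + (a * b + a * b) ≈ a * a + b * b
  square-difference a b = begin
    e * e + (a * b + a * b)                  ≈⟨ +-congˡ (+-cong (*-congʳ a≈) (*-congʳ a≈)) ⟩
    e * e + ((e + b) * b + (e + b) * b)      ≈⟨ solve 2 (λ e b →
      e :* e :+ ((e :+ b) :* b :+ (e :+ b) :* b) := (e :+ b) :* (e :+ b) :+ b :* b) ≈-refl e b ⟩
    (e + b) * (e + b) + b * b                ≈⟨ +-congʳ (*-cong a≈ a≈) ⟨
    a * a + b * b                            ∎
    where
    e = a - b
    a≈ : a ≈ e + b
    a≈ = sym (trans (+-assoc a (- b) b) (trans (+-congˡ (-‿inverseˡ b)) (+-identityʳ a)))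

  ∥-∥²-polarise : ∀ {r} (u v : Vector r) →
                  ∥ (λ p → u p - v p) ∥² + (⟨ u , v ⟩ + ⟨ u , v ⟩) ≈ ∥ u ∥² + ∥ v ∥²
  ∥-∥²-polarise {r} u v = begin
    ∥ w ∥² + (⟨ u , v ⟩ + ⟨ u , v ⟩)                        ≈⟨ +-congˡ (∑-distrib-+ uv uv) ⟨
    ∥ w ∥² + (sum λ p → uv p + uv p)                        ≈⟨ ∑-distrib-+ (λ p → w p * w p) _ ⟨
    (sum λ p → w p * w p + (uv p + uv p))                   ≈⟨ sum-cong-≋ (λ p → square-difference (u p) (v p)) ⟩
    (sum λ p → u p * u p + v p * v p)                       ≈⟨ ∑-distrib-+ (λ p → u p * u p) _ ⟩
    ∥ u ∥² + ∥ v ∥²                                         ∎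
    where
    w uv : Vector r
    w p = u p - v p
    uv p = u p * v p

  -- Orthonormal families and projection to their span.

  δ : ∀ {r} → Fin r → Vector r
  δ zero    zero    = 1#
  δ zero    (suc _) = 0#
  δ (suc _) zero    = 0#
  δ (suc i) (suc j) = δ i j

  δ-refl : ∀ {r} (i : Fin r) → δ i i ≈ 1#
  δ-refl zero    = ≈-refl
  δ-refl (suc i) = δ-refl i

  δ-≢ : ∀ {r} {i j : Fin r} → i ≢ j → δ i j ≈ 0#
  δ-≢ {i = zero}  {zero}  i≢j = contradiction ≡.refl i≢j
  δ-≢ {i = zero}  {suc j} i≢j = ≈-refl
  δ-≢ {i = suc i} {zero}  i≢j = ≈-refl
  δ-≢ {i = suc i} {suc j} i≢j = δ-≢ λ i≡j → i≢j (≡.cong suc i≡j)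

  ⟨δ,⟩ : ∀ {r} (i : Fin r) (u : Vector r) → ⟨ δ i , u ⟩ ≈ u i
  ⟨δ,⟩ {suc r} zero u = begin
    1# * u zero + (sum λ p → 0# * u (suc p))  ≈⟨ +-cong (*-identityˡ _) (⟨⟩-zeroˡ {u = λ _ → 0#} (λ _ → ≈-refl) λ p → u (suc p)) ⟩
    u zero + 0#                               ≈⟨ +-identityʳ _ ⟩
    u zero                                    ∎
  ⟨δ,⟩ {suc r} (suc i) u = begin
    0# * u zero + ⟨ δ i , (λ p → u (suc p)) ⟩  ≈⟨ +-cong (zeroˡ _) (⟨δ,⟩ i λ p → u (suc p)) ⟩
    0# + u (suc i)                             ≈⟨ +-identityˡ _ ⟩
    u (suc i)                                  ∎

  Orthonormal : ∀ {k l} → Matrix k l → Set ℓ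
  Orthonormal U = ∀ p q → ⟨ U p , U q ⟩ ≈ δ p q

  -- Expanding the square and moving the sum over coordinates innermost leaves the Gram matrix of
  -- the rows, which is `δ`.
  ∥combination∥² : ∀ {k l} (U : Matrix k l) → Orthonormal U → (a : Vector k) →
                   ∥ (λ q → sum λ e → a e * U e q) ∥² ≈ ∥ a ∥²
  ∥combination∥² {k} {l} U orth a = begin
    (sum λ q → w q * w q)                                                 ≈⟨ sum-cong-≋ (λ q → sum-*-sum (λ e → a e * U e q) λ f → a f * U f q) ⟩
    (sum λ q → sum λ e → sum λ f → a e * U e q * (a f * U f q))           ≈⟨ ∑-comm (λ q e → sum λ f → a e * U e q * (a f * U f q)) ⟩
    (sum λ e → sum λ q → sum λ f → a e * U e q * (a f * U f q))           ≈⟨ sum-cong-≋ (λ e → ∑-comm (λ q f → a e * U e q * (a f * U f q))) ⟩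
    (sum λ e → sum λ f → sum λ q → a e * U e q * (a f * U f q))           ≈⟨ sum-cong-≋ (λ e → sum-cong-≋ λ f → term e f) ⟩
    (sum λ e → sum λ f → δ e f * (a e * a f))                             ≈⟨ sum-cong-≋ (λ e → ⟨δ,⟩ e λ f → a e * a f) ⟩
    (sum λ e → a e * a e)                                                 ∎
    where
    w : Vector l
    w q = sum λ e → a e * U e q
    term : ∀ e f → (sum λ q → a e * U e q * (a f * U f q)) ≈ δ e f * (a e * a f)
    term e f = begin
      (sum λ q → a e * U e q * (a f * U f q))      ≈⟨ sum-cong-≋ (λ q → solve 4 (λ a b c d →
        a :* b :* (c :* d) := (b :* d) :* (a :* c)) ≈-refl (a e) (U e q) (a f) (U f q)) ⟩
      (sum λ q → U e q * U f q * (a e * a f))      ≈⟨ *-distribʳ-sum (a e * a f) (λ q → U e q * U f q) ⟨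
      ⟨ U e , U f ⟩ * (a e * a f)                  ≈⟨ *-congʳ (orth e f) ⟩
      δ e f * (a e * a f)                          ∎

  -- The remainder of the unit vector δ p after projection to the span of the rows of U.
  residue : ∀ {k l} → Matrix k l → Fin l → Vector l
  residue U p q = δ p q - sum λ e → U e p * U e q

  -- Pythagoras for the projection `w` of `δ p` to the row span: `⟨ δ p , w ⟩` is `w p`, which is
  -- `∥a∥²` by definition, and `∥ w ∥²` is `∥a∥²` by `∥combination∥²`.
  ∥residue∥² : ∀ {k l} (U : Matrix k l) → Orthonormal U → ∀ p →
               ∥ residue U p ∥² + ∥ (λ e → U e p) ∥² ≈ 1#
  ∥residue∥² {k} {l} U orth p = +-cancelʳ ∥a∥² _ _ (begin
    ∥ residue U p ∥² + ∥a∥² + ∥a∥²                         ≈⟨ +-assoc _ _ _ ⟩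
    ∥ residue U p ∥² + (∥a∥² + ∥a∥²)                       ≈⟨ +-congˡ (+-cong (⟨δ,⟩ p w) (⟨δ,⟩ p w)) ⟨
    ∥ residue U p ∥² + (⟨ δ p , w ⟩ + ⟨ δ p , w ⟩)         ≈⟨ ∥-∥²-polarise (δ p) w ⟩
    ∥ δ p ∥² + ∥ w ∥²                                      ≈⟨ +-cong (trans (⟨δ,⟩ p (δ p)) (δ-refl p)) (∥combination∥² U orth λ e → U e p) ⟩
    1# + ∥a∥²                                              ∎)
    where
    w : Vector l
    w q = sum λ e → U e p * U e q
    ∥a∥² : Carrier
    ∥a∥² = ∥ (λ e → U e p) ∥²

  -- The sum of the residues is the trace of the projection to the orthogonal complement of the row
  -- span, that is, `l` minus `k`; moving `k` to the left avoids the subtraction.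
  sum-∥residue∥² : ∀ {k l} (U : Matrix k l) → Orthonormal U →
                   (sum λ p → ∥ residue U p ∥²) + k · 1# ≈ l · 1#
  sum-∥residue∥² {k} {l} U orth = begin
    S + k · 1#                                            ≈⟨ +-congˡ (sum-replicate k) ⟨
    S + (sum {k} λ _ → 1#)                                ≈⟨ +-congˡ (sum-cong-≋ λ e → trans (orth e e) (δ-refl e)) ⟨
    S + (sum λ e → ∥ U e ∥²)                              ≈⟨ +-congˡ (∑-comm λ e p → U e p * U e p) ⟩
    S + (sum λ p → ∥ (λ e → U e p) ∥²)                    ≈⟨ ∑-distrib-+ (λ p → ∥ residue U p ∥²) _ ⟨
    (sum λ p → ∥ residue U p ∥² + ∥ (λ e → U e p) ∥²)     ≈⟨ sum-cong-≋ (∥residue∥² U orth) ⟩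
    (sum {l} λ _ → 1#)                                    ≈⟨ sum-replicate l ⟩
    l · 1#                                                ∎
    where
    S : Carrier
    S = sum λ p → ∥ residue U p ∥²

  -- Bilinear forms and the polarisation of a sum of their squares.

  bilinear : ∀ {m n} → Matrix m n → Vector m → Vector n → Carrier
  bilinear b x y = sum λ i → sum λ j → b i j * x i * y j

  bilinear-+ˡ : ∀ {m n} (b : Matrix m n) x x′ y →
                bilinear b (λ i → x i + x′ i) y ≈ bilinear b x y + bilinear b x′ y
  bilinear-+ˡ b x x′ y = begin
    (sum λ i → sum λ j → b i j * (x i + x′ i) * y j)
      ≈⟨ sum-cong-≋ (λ i → sum-cong-≋ λ j → solve 4 (λ b x x′ y →
           b :* (x :+ x′) :* y := b :* x :* y :+ b :* x′ :* y) ≈-refl (b i j) (x i) (x′ i) (y j)) ⟩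
    (sum λ i → sum λ j → b i j * x i * y j + b i j * x′ i * y j)
      ≈⟨ sum-cong-≋ (λ i → ∑-distrib-+ (λ j → b i j * x i * y j) _) ⟩
    (sum λ i → (sum λ j → b i j * x i * y j) + (sum λ j → b i j * x′ i * y j))
      ≈⟨ ∑-distrib-+ (λ i → sum λ j → b i j * x i * y j) _ ⟩
    bilinear b x y + bilinear b x′ y ∎

  bilinear-+ʳ : ∀ {m n} (b : Matrix m n) x y y′ →
                bilinear b x (λ j → y j + y′ j) ≈ bilinear b x y + bilinear b x y′
  bilinear-+ʳ b x y y′ = begin
    (sum λ i → sum λ j → b i j * x i * (y j + y′ j))
      ≈⟨ sum-cong-≋ (λ i → sum-cong-≋ λ j → distribˡ (b i j * x i) (y j) (y′ j)) ⟩
    (sum λ i → sum λ j → b i j * x i * y j + b i j * x i * y′ j)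
      ≈⟨ sum-cong-≋ (λ i → ∑-distrib-+ (λ j → b i j * x i * y j) _) ⟩
    (sum λ i → (sum λ j → b i j * x i * y j) + (sum λ j → b i j * x i * y′ j))
      ≈⟨ ∑-distrib-+ (λ i → sum λ j → b i j * x i * y j) _ ⟩
    bilinear b x y + bilinear b x y′ ∎

  bilinear-δ : ∀ {m n} (b : Matrix m n) i j → bilinear b (δ i) (δ j) ≈ b i j
  bilinear-δ b i j = begin
    (sum λ k → sum λ l → b k l * δ i k * δ j l)
      ≈⟨ sum-cong-≋ (λ k → sum-cong-≋ λ l → *-comm (b k l * δ i k) (δ j l)) ⟩
    (sum λ k → ⟨ δ j , (λ l → b k l * δ i k) ⟩)  ≈⟨ sum-cong-≋ (λ k → ⟨δ,⟩ j λ l → b k l * δ i k) ⟩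
    (sum λ k → b k j * δ i k)                    ≈⟨ ⟨⟩-comm (λ k → b k j) (δ i) ⟩
    ⟨ δ i , (λ k → b k j) ⟩                      ≈⟨ ⟨δ,⟩ i (λ k → b k j) ⟩
    b i j                                        ∎

  sumOfSquares : ∀ {m n r} → (Fin r → Matrix m n) → Vector m → Vector n → Carrier
  sumOfSquares f x y = sum λ p → bilinear (f p) x y * bilinear (f p) x y

  entries : ∀ {m n r} → (Fin r → Matrix m n) → Fin m → Fin n → Vector r
  entries f i j p = f p i j

  -- The two products that contribute to the monomial xᵢxₖyⱼyₗ of the sum of squares.
  mixed : ∀ {m n r} → (Fin r → Matrix m n) → Fin m → Fin n → Fin m → Fin n → Carrier
  mixed f i j k l = ⟨ entries f i j , entries f k l ⟩ + ⟨ entries f i l , entries f k j ⟩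

  module _ {m n r : ℕ} (f : Fin r → Matrix m n) (x x′ : Vector m) (y y′ : Vector n) where
    private
      _∔_ : ∀ {k} → Vector k → Vector k → Vector k
      (u ∔ v) p = u p + v p

      Q : Vector m → Vector n → Carrier
      Q = sumOfSquares f

      a b c′ d : Vector r
      a p  = bilinear (f p) x  y
      b p  = bilinear (f p) x  y′
      c′ p = bilinear (f p) x′ y
      d p  = bilinear (f p) x′ y′

      square : ∀ {u v} → u ≈ v → u * u ≈ v * v
      square u≈v = *-cong u≈v u≈v

      5-sum : (s t u v w : Vector r) →
              (sum λ p → s p + t p + u p + v p + w p) ≈ sum s + sum t + sum u + sum v + sum w
      5-sum s t u v w =
        trans (∑-distrib-+ (λ p → s p + t p + u p + v p) w) (+-congʳ
        (trans (∑-distrib-+ (λ p → s p + t p + u p) v) (+-congʳ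
        (trans (∑-distrib-+ (λ p → s p + t p) u) (+-congʳ
        (∑-distrib-+ s t))))))

    -- Inclusion–exclusion for the quadratic form (x , y) ↦ Σ fₚ(x,y)² in each of x and y.
    polarisation :
      Q (x ∔ x′) (y ∔ y′) + Q x y + Q x y′ + Q x′ y + Q x′ y′
      ≈ ((⟨ a , d ⟩ + ⟨ b , c′ ⟩) + (⟨ a , d ⟩ + ⟨ b , c′ ⟩))
        + Q x (y ∔ y′) + Q x′ (y ∔ y′) + Q (x ∔ x′) y + Q (x ∔ x′) y′
    polarisation = begin
      Q (x ∔ x′) (y ∔ y′) + Q x y + Q x y′ + Q x′ y + Q x′ y′
        ≈⟨ +-congʳ (+-congʳ (+-congʳ (+-congʳ (sum-cong-≋ λ p → square (
             trans (bilinear-+ˡ (f p) x x′ _)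
                   (+-cong (bilinear-+ʳ (f p) x y y′) (bilinear-+ʳ (f p) x′ y y′))))))) ⟩
      (sum λ p → (a p + b p + (c′ p + d p)) * (a p + b p + (c′ p + d p)))
        + ∥ a ∥² + ∥ b ∥² + ∥ c′ ∥² + ∥ d ∥²
        ≈⟨ 5-sum _ _ _ _ _ ⟨
      (sum λ p → (a p + b p + (c′ p + d p)) * (a p + b p + (c′ p + d p))
                   + a p * a p + b p * b p + c′ p * c′ p + d p * d p)
        ≈⟨ sum-cong-≋ (λ p → solve 4 (λ a b c d →
             (a :+ b :+ (c :+ d)) :* (a :+ b :+ (c :+ d)) :+ a :* a :+ b :* b :+ c :* c :+ d :* d :=
             ((a :* d :+ b :* c) :+ (a :* d :+ b :* c)) :+ (a :+ b) :* (a :+ b) :+ (c :+ d) :* (c :+ d)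
               :+ (a :+ c) :* (a :+ c) :+ (b :+ d) :* (b :+ d))
             ≈-refl (a p) (b p) (c′ p) (d p)) ⟩
      (sum λ p → ((a p * d p + b p * c′ p) + (a p * d p + b p * c′ p))
                   + (a p + b p) * (a p + b p) + (c′ p + d p) * (c′ p + d p)
                   + (a p + c′ p) * (a p + c′ p) + (b p + d p) * (b p + d p))
        ≈⟨ 5-sum _ _ _ _ _ ⟩
      (sum λ p → (a p * d p + b p * c′ p) + (a p * d p + b p * c′ p))
        + (sum λ p → (a p + b p) * (a p + b p)) + (sum λ p → (c′ p + d p) * (c′ p + d p))
        + (sum λ p → (a p + c′ p) * (a p + c′ p)) + (sum λ p → (b p + d p) * (b p + d p))
        ≈⟨ +-cong (+-cong (+-cong (+-cong
             (trans (∑-distrib-+ ad+bc ad+bc) (+-cong ad+bc≈ ad+bc≈))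
             (sum-cong-≋ λ p → square (sym (bilinear-+ʳ (f p) x y y′))))
             (sum-cong-≋ λ p → square (sym (bilinear-+ʳ (f p) x′ y y′))))
             (sum-cong-≋ λ p → square (sym (bilinear-+ˡ (f p) x x′ y))))
             (sum-cong-≋ λ p → square (sym (bilinear-+ˡ (f p) x x′ y′))) ⟩
      ((⟨ a , d ⟩ + ⟨ b , c′ ⟩) + (⟨ a , d ⟩ + ⟨ b , c′ ⟩))
        + Q x (y ∔ y′) + Q x′ (y ∔ y′) + Q (x ∔ x′) y + Q (x ∔ x′) y′ ∎
      where
      ad+bc : Vector r
      ad+bc p = a p * d p + b p * c′ p
      ad+bc≈ : sum ad+bc ≈ ⟨ a , d ⟩ + ⟨ b , c′ ⟩
      ad+bc≈ = ∑-distrib-+ (λ p → a p * d p) _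

  -- Polarisation at basis vectors: apart from `mixed`, every term is a value of the form and hence
  -- the same for `f` and `g`. Those that stand beside `mixed`, namely `F₁` to `F₄`, are cancelled
  -- one by one.
  double-mixed-cong : ∀ {m n r s} (f : Fin r → Matrix m n) (g : Fin s → Matrix m n) →
    (∀ x y → sumOfSquares f x y ≈ sumOfSquares g x y) →
    ∀ i j k l → mixed f i j k l + mixed f i j k l ≈ mixed g i j k l + mixed g i j k l
  double-mixed-cong f g f≈g i j k l =
    +-cancelʳ _ _ _ (+-cancelʳ _ _ _ (+-cancelʳ _ _ _ (+-cancelʳ _ _ _ (begin
      mixed f i j k l + mixed f i j k l + F₁ + F₂ + F₃ + F₄
        ≈⟨ +-congʳ (+-congʳ (+-congʳ (+-congʳ (+-cong (values f) (values f))))) ⟨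
      _ ≈⟨ polarisation f (δ i) (δ k) (δ j) (δ l) ⟨
      _ ≈⟨ +-cong (+-cong (+-cong (+-cong (f≈g _ _) (f≈g _ _)) (f≈g _ _)) (f≈g _ _)) (f≈g _ _) ⟩
      _ ≈⟨ polarisation g (δ i) (δ k) (δ j) (δ l) ⟩
      _ ≈⟨ +-cong (+-cong (+-cong (+-cong (+-cong (values g) (values g))
             (sym (f≈g _ _))) (sym (f≈g _ _))) (sym (f≈g _ _))) (sym (f≈g _ _)) ⟩
      mixed g i j k l + mixed g i j k l + F₁ + F₂ + F₃ + F₄ ∎))))
    where
    F₁ = sumOfSquares f (δ i) (λ q → δ j q + δ l q)
    F₂ = sumOfSquares f (δ k) (λ q → δ j q + δ l q)
    F₃ = sumOfSquares f (λ p → δ i p + δ k p) (δ j)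
    F₄ = sumOfSquares f (λ p → δ i p + δ k p) (δ l)
    values : ∀ {r} (h : Fin r → Matrix _ _) →
      ⟨ (λ p → bilinear (h p) (δ i) (δ j)) , (λ p → bilinear (h p) (δ k) (δ l)) ⟩
      + ⟨ (λ p → bilinear (h p) (δ i) (δ l)) , (λ p → bilinear (h p) (δ k) (δ j)) ⟩
      ≈ mixed h i j k l
    values h = +-cong
      (⟨⟩-cong (λ p → bilinear-δ (h p) i j) (λ p → bilinear-δ (h p) k l))
      (⟨⟩-cong (λ p → bilinear-δ (h p) i l) (λ p → bilinear-δ (h p) k j))

  -- Expansion of a sum of squares into biquadratic coefficients.

  Tensor : ℕ → ℕ → Set c
  Tensor m n = Fin m → Fin m → Fin n → Fin n → Carrier

  -- The nesting order row, row, column, column is that of `evalBiquadratic`, so that over the reals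
  -- the two agree by computation.
  sum⁴ : ∀ {m n} → Tensor m n → Carrier
  sum⁴ t = sum λ i → sum λ k → sum λ j → sum λ l → t i k j l

  sum⁴-cong : ∀ {m n} {s t : Tensor m n} → (∀ i k j l → s i k j l ≈ t i k j l) → sum⁴ s ≈ sum⁴ t
  sum⁴-cong s≈t = sum-cong-≋ λ i → sum-cong-≋ λ k → sum-cong-≋ λ j → sum-cong-≋ λ l → s≈t i k j l

  sum⁴-+ : ∀ {m n} (s t : Tensor m n) → sum⁴ (λ i k j l → s i k j l + t i k j l) ≈ sum⁴ s + sum⁴ t
  sum⁴-+ s t =
    trans (sum-cong-≋ λ i →
      trans (sum-cong-≋ λ k →
        trans (sum-cong-≋ λ j → ∑-distrib-+ (s i k j) (t i k j))
              (∑-distrib-+ (λ j → sum (s i k j)) _))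
            (∑-distrib-+ (λ k → sum λ j → sum (s i k j)) _))
          (∑-distrib-+ (λ i → sum λ k → sum λ j → sum (s i k j)) _)

  sum⁴-swap : ∀ {m n} (t : Tensor m n) → sum⁴ (λ i k j l → t i k l j) ≈ sum⁴ t
  sum⁴-swap t = sum-cong-≋ λ i → sum-cong-≋ λ k → ∑-comm λ j l → t i k l j

  sum⁴-sum : ∀ {m n r} (t : Fin r → Tensor m n) →
             sum⁴ (λ i k j l → sum λ p → t p i k j l) ≈ sum λ p → sum⁴ (t p)
  sum⁴-sum t =
    trans (sum-cong-≋ λ i →
      trans (sum-cong-≋ λ k →
        trans (sum-cong-≋ λ j → ∑-comm λ l p → t p i k j l)
              (∑-comm λ j p → sum (t p i k j)))
            (∑-comm λ k p → sum λ j → sum (t p i k j)))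
          (∑-comm λ i p → sum λ k → sum λ j → sum (t p i k j))

  bilinear² : ∀ {m n} (b : Matrix m n) x y →
              bilinear b x y * bilinear b x y ≈ sum⁴ λ i k j l → b i j * x i * y j * (b k l * x k * y l)
  bilinear² {m} {n} b x y = trans (sum-*-sum (λ i → sum (term i)) λ k → sum (term k))
    (sum-cong-≋ λ i → sum-cong-≋ λ k → sum-*-sum (term i) (term k))
    where
    term : Matrix m n
    term i j = b i j * x i * y j

  -- h is one half; averaging the two contributions to xᵢxₖyⱼyₗ makes the coefficients symmetric.
  coefficient : ∀ {m n r} → Carrier → (Fin r → Matrix m n) → Fin m → Fin n → Fin m → Fin n → Carrier
  coefficient h f i j k l = sum λ p → h * (f p i j * f p k l + f p i l * f p k j)

  coefficient-sym₁ : ∀ {m n r} h (f : Fin r → Matrix m n) i j k l →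
                     coefficient h f i j k l ≈ coefficient h f k j i l
  coefficient-sym₁ h f i j k l = sum-cong-≋ λ p → *-congˡ (solve 4 (λ a b c d →
    a :* b :+ c :* d := d :* c :+ b :* a) ≈-refl (f p i j) (f p k l) (f p i l) (f p k j))

  coefficient-sym₂ : ∀ {m n r} h (f : Fin r → Matrix m n) i j k l →
                     coefficient h f i j k l ≈ coefficient h f k l i j
  coefficient-sym₂ h f i j k l = sum-cong-≋ λ p → *-congˡ (solve 4 (λ a b c d →
    a :* b :+ c :* d := b :* a :+ d :* c) ≈-refl (f p i j) (f p k l) (f p i l) (f p k j))

  -- The two products averaged in `coefficient` differ by an exchange of `j` and `l`, which leaves
  -- the full sum unchanged; each therefore contributes half of the square.
  expand-squares : ∀ {m n r} {h} → h + h ≈ 1# → (f : Fin r → Matrix m n) → ∀ x y →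
    sum⁴ (λ i k j l → coefficient h f i j k l * x i * x k * y j * y l) ≈ sumOfSquares f x y
  expand-squares {m} {n} {r} {h} h+h≈1 f x y = begin
    sum⁴ (λ i k j l → coefficient h f i j k l * x i * x k * y j * y l)
      ≈⟨ sum⁴-cong (λ i k j l → trans
           (solve 5 (λ c x x′ y y′ → c :* x :* x′ :* y :* y′ := c :* (x :* x′ :* y :* y′)) ≈-refl
             (coefficient h f i j k l) (x i) (x k) (y j) (y l))
           (*-distribʳ-sum (x i * x k * y j * y l) λ p → h * (f p i j * f p k l + f p i l * f p k j))) ⟩
    sum⁴ (λ i k j l → sum λ p → h * (f p i j * f p k l + f p i l * f p k j) * (x i * x k * y j * y l))
      ≈⟨ sum⁴-sum (λ p i k j l → h * (f p i j * f p k l + f p i l * f p k j) * (x i * x k * y j * y l)) ⟩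
    (sum λ p → sum⁴ λ i k j l → h * (f p i j * f p k l + f p i l * f p k j) * (x i * x k * y j * y l))
      ≈⟨ sum-cong-≋ (λ p → trans (sum⁴-cong λ i k j l →
           solve 9 (λ h a b c d x x′ y y′ →
             h :* (a :* b :+ c :* d) :* (x :* x′ :* y :* y′) :=
             h :* (a :* x :* y :* (b :* x′ :* y′)) :+ h :* (c :* x :* y′ :* (d :* x′ :* y))) ≈-refl
             h (f p i j) (f p k l) (f p i l) (f p k j) (x i) (x k) (y j) (y l))
           (sum⁴-+ (A p) λ i k j l → A p i k l j)) ⟩
    (sum λ p → sum⁴ (A p) + sum⁴ (λ i k j l → A p i k l j))
      ≈⟨ sum-cong-≋ (λ p → trans (+-congˡ (sum⁴-swap (A p))) (sym (sum⁴-+ (A p) (A p)))) ⟩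
    (sum λ p → sum⁴ (λ i k j l → A p i k j l + A p i k j l))
      ≈⟨ sum-cong-≋ {r} (λ p → sum⁴-cong λ i k j l → trans (sym (distribʳ (B p i k j l) h h))
           (trans (*-congʳ h+h≈1) (*-identityˡ _))) ⟩
    (sum λ p → sum⁴ (B p))
      ≈⟨ sum-cong-≋ (λ p → bilinear² (f p) x y) ⟨
    sumOfSquares f x y ∎
    where
    A B : Fin r → Tensor m n
    B p i k j l = f p i j * x i * y j * (f p k l * x k * y l)
    A p i k j l = h * B p i k j l

  -- Formally real rings.

  data SumOfSquares : Carrier → Set c where
    none   : SumOfSquares 0#
    square : ∀ x → SumOfSquares (x * x)
    _⊕_    : ∀ {s t} → SumOfSquares s → SumOfSquares t → SumOfSquares (s + t)

  -- The vanishing of a term is concluded outright, instead of -1 being excluded as a sum of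
  -- squares. The two forms are classically equivalent over a field, but no inverses are assumed
  -- here.
  FormallyReal : Set (c Level.⊔ ℓ)
  FormallyReal = ∀ {x s} → SumOfSquares s → x * x + s ≈ 0# → x ≈ 0#

  sum-SumOfSquares : ∀ {r} {u : Vector r} → (∀ p → SumOfSquares (u p)) → SumOfSquares (sum u)
  sum-SumOfSquares {zero}  sos = none
  sum-SumOfSquares {suc r} sos = sos zero ⊕ sum-SumOfSquares (λ p → sos (suc p))

  ∥∥²-SumOfSquares : ∀ {r} (u : Vector r) → SumOfSquares ∥ u ∥²
  ∥∥²-SumOfSquares u = sum-SumOfSquares λ p → square (u p)

  module FormallyRealRing (formallyReal : FormallyReal) where

    -- The head is isolated by counting the rest of the norm among the squares. The spare summand
    -- `s` leaves room for a second norm, as in `unit-pairs-coincide`.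
    ∥∥²+sos≈0⇒≐0 : ∀ {r} {u : Vector r} {s} → SumOfSquares s → ∥ u ∥² + s ≈ 0# → ∀ p → u p ≈ 0#
    ∥∥²+sos≈0⇒≐0 {suc r} {u} {s} sos eq = λ where
        zero    → u₀≈0
        (suc p) → ∥∥²+sos≈0⇒≐0 sos rest≈0 p
      where
      rest : Carrier
      rest = sum λ p → u (suc p) * u (suc p)
      eq′ : u zero * u zero + (rest + s) ≈ 0#
      eq′ = trans (sym (+-assoc _ _ _)) eq
      u₀≈0 : u zero ≈ 0#
      u₀≈0 = formallyReal (∥∥²-SumOfSquares (λ p → u (suc p)) ⊕ sos) eq′
      rest≈0 : rest + s ≈ 0#
      rest≈0 = begin
        rest + s                      ≈⟨ +-identityˡ _ ⟨
        0# + (rest + s)               ≈⟨ +-congʳ (trans (*-congʳ u₀≈0) (zeroˡ _)) ⟨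
        u zero * u zero + (rest + s)  ≈⟨ eq′ ⟩
        0#                            ∎

    ∥∥²≈0⇒≐0 : ∀ {r} {u : Vector r} → ∥ u ∥² ≈ 0# → ∀ p → u p ≈ 0#
    ∥∥²≈0⇒≐0 eq = ∥∥²+sos≈0⇒≐0 none (trans (+-identityʳ _) eq)

    -- Multiplied by `x`, the hypothesis becomes a vanishing sum of two squares. This makes 2
    -- cancellable without inverting it.
    x+x≈0⇒x≈0 : ∀ {x} → x + x ≈ 0# → x ≈ 0#
    x+x≈0⇒x≈0 {x} eq = formallyReal (square x) (begin
      x * x + x * x  ≈⟨ distribˡ x x x ⟨
      x * (x + x)    ≈⟨ *-congˡ eq ⟩
      x * 0#         ≈⟨ zeroʳ x ⟩
      0#             ∎)

    difference≈0⇒≈ : ∀ {x y} → x - y ≈ 0# → x ≈ y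
    difference≈0⇒≈ {x} {y} eq = +-cancelʳ (- y) x y (trans eq (sym (-‿inverseʳ y)))

    double-injective : ∀ {x y} → x + x ≈ y + y → x ≈ y
    double-injective {x} {y} eq = difference≈0⇒≈ (x+x≈0⇒x≈0 (+-cancelʳ (y + y) _ _ (begin
      (x - y) + (x - y) + (y + y)    ≈⟨ solve 3 (λ x y z → (x :+ z) :+ (x :+ z) :+ (y :+ y) := x :+ x :+ ((z :+ y) :+ (z :+ y))) ≈-refl x y (- y) ⟩
      x + x + ((- y + y) + (- y + y))  ≈⟨ +-cong eq (+-cong (-‿inverseˡ y) (-‿inverseˡ y)) ⟩
      y + y + (0# + 0#)                ≈⟨ solve 1 (λ y → y :+ y :+ (con 0 :+ con 0) := con 0 :+ (y :+ y)) ≈-refl y ⟩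
      0# + (y + y)                     ∎)))

    mixed-unique : ∀ {m n r s} (f : Fin r → Matrix m n) (g : Fin s → Matrix m n) →
                   (∀ x y → sumOfSquares f x y ≈ sumOfSquares g x y) →
                   ∀ i j k l → mixed f i j k l ≈ mixed g i j k l
    mixed-unique f g f≈g i j k l = double-injective (double-mixed-cong f g f≈g i j k l)

    -- The sum of the squared distances ∥u − v∥² + ∥u′ − v′∥² vanishes.
    unit-pairs-coincide : ∀ {r} {u v u′ v′ : Vector r} →
      ∥ u ∥² ≈ 1# → ∥ v ∥² ≈ 1# → ∥ u′ ∥² ≈ 1# → ∥ v′ ∥² ≈ 1# →
      ⟨ u , v ⟩ + ⟨ u′ , v′ ⟩ ≈ 1# + 1# → u ≐ v
    unit-pairs-coincide {u = u} {v} {u′} {v′} u≈1 v≈1 u′≈1 v′≈1 eq p =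
      difference≈0⇒≈ (∥∥²+sos≈0⇒≐0 (∥∥²-SumOfSquares (λ p → u′ p - v′ p)) distances≈0 p)
      where
      D D′ I I′ : Carrier
      D  = ∥ (λ p → u p - v p) ∥²
      D′ = ∥ (λ p → u′ p - v′ p) ∥²
      I  = ⟨ u , v ⟩
      I′ = ⟨ u′ , v′ ⟩
      distances≈0 : D + D′ ≈ 0#
      distances≈0 = +-cancelʳ ((1# + 1#) + (1# + 1#)) _ _ (begin
        D + D′ + ((1# + 1#) + (1# + 1#))          ≈⟨ +-congˡ (+-cong eq eq) ⟨
        D + D′ + ((I + I′) + (I + I′))            ≈⟨ solve 4 (λ d d′ i i′ →
          d :+ d′ :+ ((i :+ i′) :+ (i :+ i′)) := (d :+ (i :+ i)) :+ (d′ :+ (i′ :+ i′))) ≈-refl D D′ I I′ ⟩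
        (D + (I + I)) + (D′ + (I′ + I′))          ≈⟨ +-cong (∥-∥²-polarise u v) (∥-∥²-polarise u′ v′) ⟩
        (∥ u ∥² + ∥ v ∥²) + (∥ u′ ∥² + ∥ v′ ∥²)   ≈⟨ +-cong (+-cong u≈1 v≈1) (+-cong u′≈1 v′≈1) ⟩
        (1# + 1#) + (1# + 1#)                     ≈⟨ +-identityˡ _ ⟨
        0# + ((1# + 1#) + (1# + 1#))              ∎)

    unit-vectors-coincide : ∀ {r} {u v : Vector r} →
      ∥ u ∥² ≈ 1# → ∥ v ∥² ≈ 1# → ⟨ u , v ⟩ ≈ 1# → u ≐ v
    unit-vectors-coincide u≈1 v≈1 eq = unit-pairs-coincide u≈1 v≈1 u≈1 v≈1 (+-cong eq eq)

    -- If `k` were `l + suc d`, then `sum-∥residue∥²` would make the residues and `suc d` ones add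
    -- up to zero. This is a sum of squares one of whose terms is the square of `1#`, so formal
    -- reality would give `1# ≈ 0#`.
    orthonormal⇒≤ : ¬ 1# ≈ 0# → ∀ {k l} (U : Matrix k l) → Orthonormal U → k ℕ.≤ l
    orthonormal⇒≤ 1≉0 {k} {l} U orth = ℕ.≮⇒≥ λ l<k →
      let d , k≡ = excess l<k in 1≉0 (formallyReal (residues ⊕ ones d) (too-many d k≡))
      where
      excess : l ℕ.< k → ∃[ d ] k ≡ l ℕ.+ suc d
      excess l<k = let d , eq = ℕ.m≤n⇒∃[o]m+o≡n l<k in d , ≡.trans (≡.sym eq) (≡.sym (ℕ.+-suc l d))
      S : Carrier
      S = sum λ p → ∥ residue U p ∥²
      residues : SumOfSquares S
      residues = sum-SumOfSquares λ p → ∥∥²-SumOfSquares (residue U p)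
      ones : ∀ d → SumOfSquares (sum {d} λ _ → 1# * 1#)
      ones d = sum-SumOfSquares {d} λ _ → square 1#
      too-many : ∀ d → k ≡ l ℕ.+ suc d → 1# * 1# + (S + sum {d} λ _ → 1# * 1#) ≈ 0#
      too-many d k≡ = +-cancelˡ (l · 1#) _ _ (begin
        l · 1# + (1# * 1# + (S + (sum {d} λ _ → 1# * 1#)))
          ≈⟨ +-congˡ (+-cong (*-identityˡ 1#) (+-congˡ (trans (sum-cong-≋ {d} λ _ → *-identityˡ 1#) (sum-replicate d)))) ⟩
        l · 1# + (1# + (S + d · 1#))
          ≈⟨ solve 4 (λ l o s d → l :+ (o :+ (s :+ d)) := s :+ (l :+ (o :+ d))) ≈-refl (l · 1#) 1# S (d · 1#) ⟩
        S + (l · 1# + suc d · 1#)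
          ≈⟨ +-congˡ (·-homo-+ 1# l (suc d)) ⟨
        S + (l ℕ.+ suc d) · 1#
          ≈⟨ +-congˡ (reflexive (≡.cong (_· 1#) k≡)) ⟨
        S + k · 1#
          ≈⟨ sum-∥residue∥² U orth ⟩
        l · 1#
          ≈⟨ +-identityʳ _ ⟨
        l · 1# + 0# ∎)

-- Well-foundedness of a finite acyclic relation.

module _ {A : Set} (_≟_ : DecidableEquality A) {_⟶_ : A → A → Set}
         (V : List A) (target∈V : ∀ {x y} → x ⟶ y → y ∈ V)
         (acyclic : ∀ x xs → Unique (x ∷ xs) → ¬ Linked _⟶_ (x ∷ xs ++ [ x ])) where
  private
    open DecMembership _≟_ using (_∈?_)

    extend : ∀ xs {x y} → Linked _⟶_ (xs ++ [ x ]) → x ⟶ y → Linked _⟶_ ((xs ++ [ x ]) ++ [ y ])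
    extend []           _           x⟶y = x⟶y ∷ [-]
    extend (_ ∷ [])     (r ∷ path)  x⟶y = r ∷ extend [] path x⟶y
    extend (_ ∷ z ∷ xs) (r ∷ path)  x⟶y = r ∷ extend (z ∷ xs) path x⟶y

    dropLinked : ∀ xs {ys} → Linked _⟶_ (xs ++ ys) → Linked _⟶_ ys
    dropLinked []       path = path
    dropLinked (_ ∷ xs) path = dropLinked xs (Linked.tail path)

    dropUnique : ∀ (xs : List A) {ys} → Unique (xs ++ ys) → Unique ys
    dropUnique []       uniq       = uniq
    dropUnique (_ ∷ xs) (_ ∷ uniq) = dropUnique xs uniq

    -- The segment of the path from the occurrence of `y` onwards closes up to a cycle through
    -- distinct vertices.
    no-return : ∀ {y zs} → y ∈ zs → Unique zs → ¬ Linked _⟶_ (zs ++ [ y ])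
    no-return {y} y∈zs uniq path with ∈-∃++ y∈zs
    ... | ys , ws , refl = acyclic y ws (dropUnique ys uniq)
      (dropLinked ys (≡.subst (Linked _⟶_) (++-assoc ys (y ∷ ws) [ y ]) path))

    remove-middle : ∀ as {bs} {x y : A} → x ≢ y → x ∈ as ++ y ∷ bs → x ∈ as ++ bs
    remove-middle as x≢y x∈ with ∈-++⁻ as x∈
    ... | inj₁ x∈as           = ∈-++⁺ˡ x∈as
    ... | inj₂ (here x≡y)     = contradiction x≡y x≢y
    ... | inj₂ (there x∈bs)   = ∈-++⁺ʳ as x∈bs

    length-middle : ∀ (as : List A) {y bs} → length (as ++ y ∷ bs) ≡ suc (length (as ++ bs))
    length-middle []       = refl
    length-middle (_ ∷ as) = cong suc (length-middle as)

    -- Exploration along paths without repetition: `xs ++ [ x ]` is the path so far, `rest` contains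
    -- the vertices of `V` off the path, and `k` bounds the remaining depth. A successor on the path
    -- would close a cycle; any other one is taken out of `rest`.
    search : ∀ k rest → length rest ≤ k → ∀ xs x →
             Unique (xs ++ [ x ]) → Linked _⟶_ (xs ++ [ x ]) →
             (∀ {y} → y ∈ V → y ∉ xs ++ [ x ] → y ∈ rest) → Acc (flip _⟶_) x
    search k rest len xs x uniq path cover = acc λ {y} x⟶y → step y x⟶y (y ∈? (xs ++ [ x ]))
      where
      next : ∀ y → x ⟶ y → y ∉ xs ++ [ x ] → y ∈ rest → ∀ k → length rest ≤ k → Acc (flip _⟶_) y
      next y x⟶y y∉ y∈rest k len with ∈-∃++ y∈rest
      next y x⟶y y∉ y∈rest zero    len | as , bs , refl = contradiction (≡.subst (_≤ 0) (length-middle as) len) λ ()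
      next y x⟶y y∉ y∈rest (suc k) len | as , bs , refl =
        search k (as ++ bs) (ℕ.≤-pred (≡.subst (_≤ suc k) (length-middle as) len)) (xs ++ [ x ]) y
          (Unique.++⁺ uniq ([] ∷ []) λ { (y∈ , here refl) → y∉ y∈ })
          (extend xs path x⟶y)
          λ {z} z∈V z∉ → remove-middle as (λ { refl → z∉ (∈-++⁺ʳ (xs ++ [ x ]) (here refl)) })
                            (cover z∈V (z∉ ∘ ∈-++⁺ˡ))
      step : ∀ y → x ⟶ y → Dec (y ∈ xs ++ [ x ]) → Acc (flip _⟶_) y
      step y x⟶y (yes y∈) = contradiction (extend xs path x⟶y) (no-return y∈ uniq)
      step y x⟶y (no y∉)  = next y x⟶y y∉ (cover (target∈V x⟶y) y∉) k len

  acyclic⇒wellFounded : WellFounded (flip _⟶_)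
  acyclic⇒wellFounded x =
    search (length V) V ℕ.≤-refl [] x ([] ∷ []) [-] λ y∈V _ → y∈V

-- Combinatorics of augmented graphs and their conditions.

Unique⇒lookup-injective : ∀ {A : Set} {xs : List A} → Unique xs →
                          ∀ i j → lookup xs i ≡ lookup xs j → i ≡ j
Unique⇒lookup-injective (_ ∷ _)  zero    zero    _  = refl
Unique⇒lookup-injective (x∉ ∷ _) zero    (suc j) eq = contradiction eq (All.lookup x∉ (∈-lookup j))
Unique⇒lookup-injective (x∉ ∷ _) (suc i) zero    eq = contradiction (≡.sym eq) (All.lookup x∉ (∈-lookup i))
Unique⇒lookup-injective (_ ∷ u)  (suc i) (suc j) eq = cong suc (Unique⇒lookup-injective u i j eq)

module _ {m n : ℕ} where

  infix 4 _≟ᶜ_ _≟²_ _≟ᵉ_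

  _≟ᶜ_ : DecidableEquality (Cell m n)
  _≟ᶜ_ = ≡-dec Fin._≟_ Fin._≟_

  open DecMembership _≟ᶜ_ using (_∈?_) public

  _≟²_ : DecidableEquality (TwoEdge m n)
  twoEdge a b _ ≟² twoEdge c d _ = map′
    (λ { (refl , refl) → refl }) (λ eq → cong half₁ eq , cong half₂ eq)
    ((a ≟ᶜ c) ×-dec (b ≟ᶜ d))

  _≟ᵉ_ : DecidableEquality (Edge {m} {n})
  one c ≟ᵉ one d = map′ (cong one) (λ { refl → refl }) (c ≟ᶜ d)
  one _ ≟ᵉ two _ = no λ ()
  two _ ≟ᵉ one _ = no λ ()
  two e ≟ᵉ two f = map′ (cong two) (λ { refl → refl }) (e ≟² f)

  IsHalf⇒∈ : ∀ {c : Cell m n} e → IsHalf c e → c ∈ cells (two e)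
  IsHalf⇒∈ e (inj₁ eq) = here eq
  IsHalf⇒∈ e (inj₂ eq) = there (here eq)

  ∈⇒IsHalf : ∀ {c : Cell m n} e → c ∈ cells (two e) → IsHalf c e
  ∈⇒IsHalf e (here eq)         = inj₁ eq
  ∈⇒IsHalf e (there (here eq)) = inj₂ eq

  cross : Cell m n → Cell m n → Cell m n
  cross c d = row c , col d

  -- The cells may coincide, in which case this is occupancy. Under (S) it decides whether the
  -- coefficient vectors of the edge forms at `c` and `d` have inner product 1 or 0.
  Together : AugmentedGraph m n → Cell m n → Cell m n → Set
  Together G c d = ∃[ E ] IsEdge G E × c ∈ cells E × d ∈ cells E

  module _ (G : AugmentedGraph m n) where
    open AugmentedGraph G

    edges : List Edge
    edges = map one E₁ ++ map two E₂

    length-edges : length edges ≡ size G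
    length-edges = ≡.trans (length-++ (map one E₁)) (cong₂ ℕ._+_ (length-map one E₁) (length-map two E₂))

    IsEdge⇒∈ : ∀ {E} → IsEdge G E → E ∈ edges
    IsEdge⇒∈ (one c∈) = ∈-++⁺ˡ (∈-map⁺ one c∈)
    IsEdge⇒∈ (two e∈) = ∈-++⁺ʳ (map one E₁) (∈-map⁺ two e∈)

    ∈⇒IsEdge : ∀ {E} → E ∈ edges → IsEdge G E
    ∈⇒IsEdge E∈ with ∈-++⁻ (map one E₁) E∈
    ... | inj₁ E∈₁ with _ , c∈ , refl ← ∈-map⁻ one E∈₁ = one c∈
    ... | inj₂ E∈₂ with _ , e∈ , refl ← ∈-map⁻ two E∈₂ = two e∈

    edges-unique : Unique edges
    edges-unique = Unique.++⁺
      (Unique.map⁺ (λ { refl → refl }) E₁-unique) (Unique.map⁺ (λ { refl → refl }) E₂-unique)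
      λ { (p , q) → disjoint (∈-map⁻ one p) (∈-map⁻ two q) }
      where
      disjoint : ∀ {E} → ∃[ c ] c ∈ E₁ × E ≡ one c → ¬ (∃[ e ] e ∈ E₂ × E ≡ two e)
      disjoint (_ , _ , refl) (_ , _ , ())

    covered⇒occupied : ∀ {c E} → IsEdge G E → c ∈ cells E → Occupied G c
    covered⇒occupied (one c∈)     (here refl) = inj₁ c∈
    covered⇒occupied (two {e} e∈) c∈          = inj₂ (e , e∈ , ∈⇒IsHalf e c∈)

    occupied⇒covered : ∀ {c} → Occupied G c → ∃[ E ] IsEdge G E × c ∈ cells E
    occupied⇒covered (inj₁ c∈)              = one _ , one c∈ , here refl
    occupied⇒covered (inj₂ (e , e∈ , half)) = two e , two e∈ , IsHalf⇒∈ e half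

    occupied? : ∀ c → Dec (Occupied G c)
    occupied? c = map′
      (λ any → let E , E∈ , c∈ = find any in covered⇒occupied (∈⇒IsEdge E∈) c∈)
      (λ occ → let E , isE , c∈ = occupied⇒covered occ in lose (IsEdge⇒∈ isE) c∈)
      (Any.any? (λ E → c ∈? cells E) edges)

    nondegenerate? : ∀ (e : TwoEdge m n) → Dec (Nondegenerate e)
    nondegenerate? e = ¬? (row (half₁ e) Fin.≟ row (half₂ e)) ×-dec ¬? (col (half₁ e) Fin.≟ col (half₂ e))

    module _ (condS : CondS G) where

      edge-of-cell-unique : ∀ {c E F} → IsEdge G E → IsEdge G F → c ∈ cells E → c ∈ cells F → E ≡ F
      edge-of-cell-unique (one _)  (one _)  (here refl) (here refl) = refl
      edge-of-cell-unique (one c∈) (two {e} e∈) (here refl) c∈e         = contradiction c∈ (proj₁ condS e∈ (∈⇒IsHalf e c∈e))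
      edge-of-cell-unique (two {e} e∈) (one c∈) c∈e         (here refl) = contradiction c∈ (proj₁ condS e∈ (∈⇒IsHalf e c∈e))
      edge-of-cell-unique (two {e} e∈) (two {f} f∈) c∈e c∈f with e ≟² f
      ... | yes refl = refl
      ... | no e≢f   = contradiction (∈⇒IsHalf f c∈f) (proj₂ condS e∈ f∈ e≢f (∈⇒IsHalf e c∈e))

      ¬together : ∀ {c d E F} → IsEdge G E → IsEdge G F → E ≢ F → c ∈ cells E → d ∈ cells F → ¬ Together G c d
      ¬together E∈ F∈ E≢F c∈E d∈F (H , H∈ , c∈H , d∈H) = E≢F (≡.trans
        (edge-of-cell-unique E∈ H∈ c∈E c∈H) (edge-of-cell-unique H∈ F∈ d∈H d∈F))

    Complemented : TwoEdge m n → Set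
    Complemented e = ∃[ f ] f ∈ E₂ × IsHalf (opp₁ e) f × IsHalf (opp₂ e) f

    -- Arcs from a 2-edge with a complement can lie on (permitted) 2-cycles and are left out.
    ProperArc : TwoEdge m n → TwoEdge m n → Set
    ProperArc e f = Arc G e f × ¬ Complemented e

    -- By (W2) a cycle of proper arcs has the form `e → f → e` with `f` complementary to `e`, but
    -- then the arc leaving `e` is not proper.
    ProperArc-wellFounded : CondW2 G → WellFounded (flip ProperArc)
    ProperArc-wellFounded condW2 = acyclic⇒wellFounded _≟²_ E₂
      (λ { ((_ , (f∈ , _) , _) , _) → f∈ }) no-cycle
      where
      no-cycle : ∀ e es → Unique (e ∷ es) → ¬ Linked ProperArc (e ∷ es ++ [ e ])
      no-cycle e es uniq path with condW2 e es (uniq , Linked.map proj₁ path)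
      no-cycle e _ uniq ((arc , ¬compl) ∷ _) | f , refl , _ , _ , o₁ , o₂ =
        ¬compl (f , proj₁ (proj₁ (proj₂ arc)) , o₁ , o₂)

    -- An arc requires both opposite cells of its source to be occupied, so under `Cond2` the
    -- dependency graph has no arcs. The split on the list merely exposes the first arc of the
    -- cycle.
    cond2⇒W2 : Cond2 G → CondW2 G
    cond2⇒W2 cond2 e []       (_ , (((e∈ , nd) , _ , _ , o₁ , o₂ , _) ∷ _)) = contradiction (o₁ , o₂) (cond2 e∈ nd)
    cond2⇒W2 cond2 e (_ ∷ _)  (_ , (((e∈ , nd) , _ , _ , o₁ , o₂ , _) ∷ _)) = contradiction (o₁ , o₂) (cond2 e∈ nd)

    cond2⇒W2′ : Cond2 G → CondW2′ G
    cond2⇒W2′ cond2 e∈ nd (o₁ , o₂) = cond2 e∈ nd (inj₁ o₁ , inj₁ o₂)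

    -- `Cond3` is applied at a single cell `d` of `F`: the five cells in it are `d` and the
    -- crossings of `d` with the two halves of `e`.
    vertexDisjoint⇒opposite-unoccupied : Cond3 G → ∀ {e F} → e ∈ E₂ → IsEdge G F → VertexDisjoint (two e) F →
      ¬ (∀ {c d} → c ∈ cells (two e) → d ∈ cells F → Occupied G (cross c d) × Occupied G (cross d c))
    vertexDisjoint⇒opposite-unoccupied cond3 {e} {F} e∈ F∈ (rows# , cols#) occ with F-cell F
      where
      F-cell : (F : Edge) → ∃[ c ] c ∈ cells F
      F-cell (one c) = c , here refl
      F-cell (two f) = half₁ f , here refl
    ... | d , d∈F = cond3 e∈ (row d) (col d)
      (λ eq → rows# (here eq , ∈-map⁺ row d∈F)) (λ eq → rows# (there (here eq) , ∈-map⁺ row d∈F))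
      (λ eq → cols# (here eq , ∈-map⁺ col d∈F)) (λ eq → cols# (there (here eq) , ∈-map⁺ col d∈F))
      ( covered⇒occupied F∈ d∈F , proj₂ (occ h₁ d∈F) , proj₂ (occ h₂ d∈F)
      , proj₁ (occ h₁ d∈F) , proj₁ (occ h₂ d∈F))
      where
      h₁ : half₁ e ∈ cells (two e)
      h₁ = here refl
      h₂ : half₂ e ∈ cells (two e)
      h₂ = there (here refl)

    -- Occupancy is decidable, so if the search finds no unoccupied opposite cell, all of them are
    -- occupied.
    cond3⇒W3 : Cond3 G → CondW3 G
    cond3⇒W3 cond3 {E} {F} E∈ F∈ isTwo disjoint with Any.any? (λ c → ¬? (occupied? c)) (oppositeCells E F)
    ... | yes unocc = unocc
    ... | no all-occ = ⊥-elim (absurd isTwo E∈ F∈ disjoint occ)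
      where
      stable : ∀ {c} → c ∈ oppositeCells E F → Occupied G c
      stable {c} c∈ with occupied? c
      ... | yes o = o
      ... | no ¬o = contradiction (lose c∈ ¬o) all-occ
      occ : ∀ {c d} → c ∈ cells E → d ∈ cells F → Occupied G (cross c d) × Occupied G (cross d c)
      occ c∈ d∈ = stable (∈-++⁺ˡ (∈-cartesianProduct⁺ (∈-map⁺ row c∈) (∈-map⁺ col d∈)))
                , stable (∈-++⁺ʳ (cartesianProduct (rows E) (cols F)) (∈-cartesianProduct⁺ (∈-map⁺ row d∈) (∈-map⁺ col c∈)))
      absurd : ∀ {E F} → IsTwoEdge E ⊎ IsTwoEdge F → IsEdge G E → IsEdge G F → VertexDisjoint E F →
               ¬ (∀ {c d} → c ∈ cells E → d ∈ cells F → Occupied G (cross c d) × Occupied G (cross d c))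
      absurd (inj₁ (two e)) (two e∈) F∈ dis occ = vertexDisjoint⇒opposite-unoccupied cond3 e∈ F∈ dis occ
      -- Here the 2-edge comes second, so the edges exchange roles and with them the two crossings.
      absurd (inj₂ (two f)) E∈ (two f∈) (rows# , cols#) occ =
        vertexDisjoint⇒opposite-unoccupied cond3 f∈ E∈
          ((λ { (p , q) → rows# (q , p) }) , (λ { (p , q) → cols# (q , p) }))
          λ d∈ c∈ → swap (occ c∈ d∈)

-- The sum of squares attached to a graph.

module GraphForms {c ℓ : Level} (R : CommutativeRing c ℓ) {m n : ℕ} (G : AugmentedGraph m n) where
  open CommutativeRing R hiding (zero) renaming (refl to ≈-refl)
  open BilinearAlgebra R

  edgeForm : Edge {m} {n} → Matrix m n
  edgeForm E i j = if does ((i , j) ∈? cells E) then 1# else 0#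

  edgeForms : Fin (length (edges G)) → Matrix m n
  edgeForms p = edgeForm (lookup (edges G) p)

  private
    -- The incidence vector of a cell: its coordinate `p` tells whether the `p`-th edge contains the
    -- cell.
    w : Cell m n → Vector (length (edges G))
    w c = entries edgeForms (row c) (col c)

  apart⇒⟨w,w⟩≈0 : ∀ {c d} → ¬ Together G c d → ⟨ w c , w d ⟩ ≈ 0#
  apart⇒⟨w,w⟩≈0 {c} {d} apart = trans (sum-cong-≋ zero-term) (sum-replicate-zero (length (edges G)))
    where
    zero-term : ∀ p → w c p * w d p ≈ 0#
    zero-term p with c ∈? cells (lookup (edges G) p) | d ∈? cells (lookup (edges G) p)
    ... | no _  | _      = zeroˡ _
    ... | yes _ | no _   = zeroʳ _
    ... | yes c∈ | yes d∈ = contradiction (_ , ∈⇒IsEdge G (∈-lookup p) , c∈ , d∈) apart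

  module _ (condS : CondS G) where

    -- By (S) an occupied cell lies in exactly one edge, so its incidence vector is a standard basis
    -- vector.
    w≐δ : ∀ {c E} → IsEdge G E → (E∈ : E ∈ edges G) → c ∈ cells E → w c ≐ δ (Any.index E∈)
    w≐δ {c} {E} isE E∈ c∈E p with c ∈? cells (lookup (edges G) p)
    ... | yes c∈ = sym (trans (reflexive (cong (λ q → δ q p) q≡p)) (δ-refl p))
      where
      q≡p : Any.index E∈ ≡ p
      q≡p = Unique⇒lookup-injective (edges-unique G) _ _ (≡.trans (≡.sym (lookup-index E∈))
        (edge-of-cell-unique G condS isE (∈⇒IsEdge G (∈-lookup p)) c∈E c∈))
    ... | no c∉ = sym (δ-≢ {i = Any.index E∈} λ { refl → c∉ (≡.subst (λ F → c ∈ cells F) (lookup-index E∈) c∈E) })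

    together⇒⟨w,w⟩≈1 : ∀ {c d} → Together G c d → ⟨ w c , w d ⟩ ≈ 1#
    together⇒⟨w,w⟩≈1 {c} {d} (E , isE , c∈ , d∈) =
      trans (⟨⟩-cong (w≐δ isE E∈ c∈) (w≐δ isE E∈ d∈)) (trans (⟨δ,⟩ i (δ i)) (δ-refl i))
      where
      E∈ : E ∈ edges G
      E∈ = IsEdge⇒∈ G isE
      i : Fin (length (edges G))
      i = Any.index E∈

-- Coefficient vectors of an arbitrary representation of the graph's form.

module Representation {c ℓ : Level} (R : CommutativeRing c ℓ) (formallyReal : BilinearAlgebra.FormallyReal R)
  {m n : ℕ} (G : AugmentedGraph m n) (admissible : WeaklyAdmissible G)
  {l : ℕ} (f : Fin l → Fin m → Fin n → CommutativeRing.Carrier R)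
  (f≈G : ∀ x y → CommutativeRing._≈_ R
           (BilinearAlgebra.sumOfSquares R f x y)
           (BilinearAlgebra.sumOfSquares R (GraphForms.edgeForms R G) x y)) where
  open CommutativeRing R hiding (zero) renaming (refl to ≈-refl)
  open BilinearAlgebra R
  open FormallyRealRing formallyReal
  open GraphForms R G
  open AugmentedGraph G

  private
    condS : CondS G
    condS = proj₁ admissible

    condW1 : CondW1 G
    condW1 = proj₁ (proj₂ admissible)

    condW2 : CondW2 G
    condW2 = proj₁ (proj₂ (proj₂ admissible))

    condW2′ : CondW2′ G
    condW2′ = proj₁ (proj₂ (proj₂ (proj₂ admissible)))

    condW3 : CondW3 G
    condW3 = proj₂ (proj₂ (proj₂ (proj₂ admissible)))

    w : Cell m n → Vector (length (edges G))
    w c = entries edgeForms (row c) (col c)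

  v : Cell m n → Vector l
  v c = entries f (row c) (col c)

  -- The form determines only this sum over a pair of cells and its crossing pair. What follows
  -- hinges on when one summand can be determined separately.
  crossing : ∀ c d → ⟨ v c , v d ⟩ + ⟨ v (cross c d) , v (cross d c) ⟩
                   ≈ ⟨ w c , w d ⟩ + ⟨ w (cross c d) , w (cross d c) ⟩
  crossing c d = mixed-unique f edgeForms f≈G (row c) (col c) (row d) (col d)

  -- On a common row or column the crossing pair is the pair itself up to order, so `crossing`
  -- determines twice the inner product.
  collinear : ∀ c d → row c ≡ row d ⊎ col c ≡ col d → ⟨ v c , v d ⟩ ≈ ⟨ w c , w d ⟩
  collinear c d (inj₁ refl) = double-injective (trans (+-congˡ (⟨⟩-comm (v c) (v d)))
    (trans (crossing c d) (+-congˡ (⟨⟩-comm (w d) (w c)))))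
  collinear c d (inj₂ refl) = double-injective (crossing c d)

  v-unoccupied : ∀ {c} → ¬ Occupied G c → ∀ p → v c p ≈ 0#
  v-unoccupied {c} unocc = ∥∥²≈0⇒≐0 (trans (collinear c c (inj₁ refl)) (apart⇒⟨w,w⟩≈0
    λ { (_ , isE , c∈ , _) → unocc (covered⇒occupied G isE c∈) }))

  v-occupied : ∀ {c} → Occupied G c → ∥ v c ∥² ≈ 1#
  v-occupied {c} occ =
    let E , isE , c∈ = occupied⇒covered G occ
    in trans (collinear c c (inj₁ refl)) (together⇒⟨w,w⟩≈1 condS (E , isE , c∈ , c∈))

  unoccupied⇒⟂ : ∀ {c d} → ¬ Occupied G c ⊎ ¬ Occupied G d → ⟨ v c , v d ⟩ ≈ 0#
  unoccupied⇒⟂ {c} {d} (inj₁ c-unocc) = ⟨⟩-zeroˡ (v-unoccupied c-unocc) (v d)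
  unoccupied⇒⟂ {c} {d} (inj₂ d-unocc) = trans (⟨⟩-comm (v c) (v d)) (⟨⟩-zeroˡ (v-unoccupied d-unocc) (v c))

  -- If the crossing pair is orthogonal in both representations, `crossing` isolates the other
  -- product.
  crossing-⟂ : ∀ {c d} → ¬ Together G (cross c d) (cross d c) → ⟨ v (cross c d) , v (cross d c) ⟩ ≈ 0# →
               ⟨ v c , v d ⟩ ≈ ⟨ w c , w d ⟩
  crossing-⟂ {c} {d} apart ⟂ = begin
    ⟨ v c , v d ⟩                                              ≈⟨ +-identityʳ _ ⟨
    ⟨ v c , v d ⟩ + 0#                                         ≈⟨ +-congˡ ⟂ ⟨
    ⟨ v c , v d ⟩ + ⟨ v (cross c d) , v (cross d c) ⟩          ≈⟨ crossing c d ⟩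
    ⟨ w c , w d ⟩ + ⟨ w (cross c d) , w (cross d c) ⟩          ≈⟨ +-congˡ (apart⇒⟨w,w⟩≈0 apart) ⟩
    ⟨ w c , w d ⟩ + 0#                                         ≈⟨ +-identityʳ _ ⟩
    ⟨ w c , w d ⟩                                              ∎
    where open Relation.Binary.Reasoning.Setoid setoid

  crossing-unoccupied : ∀ {c d} → ¬ Occupied G (cross c d) ⊎ ¬ Occupied G (cross d c) →
                        ⟨ v c , v d ⟩ ≈ ⟨ w c , w d ⟩
  crossing-unoccupied {c} {d} unocc = crossing-⟂ {c} {d}
    (λ { (_ , isE , c∈ , d∈) → Sum.[ (λ u → u (covered⇒occupied G isE c∈)) , (λ u → u (covered⇒occupied G isE d∈)) ] unocc })
    (unoccupied⇒⟂ unocc)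

  -- Rigidity of edges and orthogonality of distinct edges.

  Rigid : Edge {m} {n} → Set ℓ
  Rigid E = ∀ {c d} → c ∈ cells E → d ∈ cells E → v c ≐ v d

  rigid-one : ∀ c → Rigid (one c)
  rigid-one c (here refl) (here refl) p = ≈-refl

  rigid-two : ∀ e → v (half₁ e) ≐ v (half₂ e) → Rigid (two e)
  rigid-two e eq (here refl)         (here refl)         p = ≈-refl
  rigid-two e eq (here refl)         (there (here refl)) p = eq p
  rigid-two e eq (there (here refl)) (here refl)         p = sym (eq p)
  rigid-two e eq (there (here refl)) (there (here refl)) p = ≈-refl

  module _ {e : TwoEdge m n} (e∈ : e ∈ E₂) where
    private
      halves-together : Together G (half₁ e) (half₂ e)
      halves-together = two e , two e∈ , here refl , there (here refl)

      ∥half₁∥²≈1 : ∥ v (half₁ e) ∥² ≈ 1#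
      ∥half₁∥²≈1 = v-occupied (covered⇒occupied G (two e∈) (here refl))

      ∥half₂∥²≈1 : ∥ v (half₂ e) ∥² ≈ 1#
      ∥half₂∥²≈1 = v-occupied (covered⇒occupied G (two e∈) (there (here refl)))

    -- The halves lie in one edge, so the given product is 1, and unit vectors with inner product 1
    -- coincide.
    ⟨halves⟩⇒rigid : ⟨ v (half₁ e) , v (half₂ e) ⟩ ≈ ⟨ w (half₁ e) , w (half₂ e) ⟩ → Rigid (two e)
    ⟨halves⟩⇒rigid eq = rigid-two e
      (unit-vectors-coincide ∥half₁∥²≈1 ∥half₂∥²≈1 (trans eq (together⇒⟨w,w⟩≈1 condS halves-together)))

    degenerate⇒rigid : ¬ Nondegenerate e → Rigid (two e)
    degenerate⇒rigid deg = ⟨halves⟩⇒rigid (collinear (half₁ e) (half₂ e) line)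
      where
      line : row (half₁ e) ≡ row (half₂ e) ⊎ col (half₁ e) ≡ col (half₂ e)
      line with row (half₁ e) Fin.≟ row (half₂ e) | col (half₁ e) Fin.≟ col (half₂ e)
      ... | yes eq | _      = inj₁ eq
      ... | no _   | yes eq = inj₂ eq
      ... | no r≢  | no c≢  = contradiction (r≢ , c≢) deg

    -- When one edge holds both opposite cells, `crossing` gives the two inner products only in sum.
    -- That sum is 2, which for unit vectors still forces equality within each pair.
    complemented⇒rigid : Together G (opp₁ e) (opp₂ e) → Rigid (two e)
    complemented⇒rigid tog@(_ , isF , o₁∈ , o₂∈) = rigid-two e (unit-pairs-coincide
      ∥half₁∥²≈1 ∥half₂∥²≈1 (v-occupied (covered⇒occupied G isF o₁∈)) (v-occupied (covered⇒occupied G isF o₂∈))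
      (trans (crossing (half₁ e) (half₂ e))
        (+-cong (together⇒⟨w,w⟩≈1 condS halves-together) (together⇒⟨w,w⟩≈1 condS tog))))

  -- Rigidity lets the inner product be evaluated at whichever cells `s` and `t` of the two edges
  -- make it known.
  transfer-⟂ : ∀ {E F} → IsEdge G E → IsEdge G F → E ≢ F → Rigid E → Rigid F →
               ∀ {c d s t} → c ∈ cells E → d ∈ cells F → s ∈ cells E → t ∈ cells F →
               ⟨ v s , v t ⟩ ≈ ⟨ w s , w t ⟩ → ⟨ v c , v d ⟩ ≈ 0#
  transfer-⟂ isE isF E≢F rigidE rigidF c∈ d∈ s∈ t∈ eq = trans
    (⟨⟩-cong (rigidE c∈ s∈) (rigidF d∈ t∈))
    (trans eq (apart⇒⟨w,w⟩≈0 (¬together G condS isE isF E≢F s∈ t∈)))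

  -- If the edges have cells on a common row or column, `collinear` applies to these. Otherwise they
  -- are vertex-disjoint, and (W3) supplies an unoccupied opposite cell, which annihilates the
  -- crossing term of the cells `s` and `t` that span it.
  rigid⇒⟂ : ∀ {E F} → IsEdge G E → IsEdge G F → E ≢ F → IsTwoEdge E ⊎ IsTwoEdge F →
            Rigid E → Rigid F → ∀ {c d} → c ∈ cells E → d ∈ cells F → ⟨ v c , v d ⟩ ≈ 0#
  rigid⇒⟂ {E} {F} isE isF E≢F isTwo rigidE rigidF {c} {d} c∈ d∈
    with Any.any? (λ s → Any.any? (λ t → (row s Fin.≟ row t) ⊎-dec (col s Fin.≟ col t)) (cells F)) (cells E)
  ... | yes any = let s , s∈ , any′ = find any
                      t , t∈ , line = find any′
                  in transfer-⟂ isE isF E≢F rigidE rigidF c∈ d∈ s∈ t∈ (collinear s t line)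
  ... | no ¬any = opposite (condW3 isE isF isTwo (rows# , cols#))
    where
    via : ∀ {s t} → s ∈ cells E → t ∈ cells F → ⟨ v s , v t ⟩ ≈ ⟨ w s , w t ⟩ → ⟨ v c , v d ⟩ ≈ 0#
    via = transfer-⟂ isE isF E≢F rigidE rigidF c∈ d∈
    rows# : ∀ {i} → ¬ (i ∈ rows E × i ∈ rows F)
    rows# (p , q) with ∈-map⁻ row p | ∈-map⁻ row q
    ... | s , s∈ , eq | t , t∈ , eq′ = ¬any (lose s∈ (lose t∈ (inj₁ (≡.trans (≡.sym eq) eq′))))
    cols# : ∀ {j} → ¬ (j ∈ cols E × j ∈ cols F)
    cols# (p , q) with ∈-map⁻ col p | ∈-map⁻ col q
    ... | s , s∈ , eq | t , t∈ , eq′ = ¬any (lose s∈ (lose t∈ (inj₂ (≡.trans (≡.sym eq) eq′))))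
    opposite : Any (λ c → ¬ Occupied G c) (oppositeCells E F) → ⟨ v c , v d ⟩ ≈ 0#
    opposite any with find any
    ... | o , o∈ , unocc with ∈-++⁻ (cartesianProduct (rows E) (cols F)) o∈
    ... | inj₁ o∈EF with ∈-cartesianProduct⁻ (rows E) (cols F) o∈EF
    ...   | i∈ , j∈ with ∈-map⁻ row i∈ | ∈-map⁻ col j∈
    ...     | s , s∈ , refl | t , t∈ , refl = via s∈ t∈ (crossing-unoccupied {s} {t} (inj₁ unocc))
    opposite any | o , o∈ , unocc | inj₂ o∈FE with ∈-cartesianProduct⁻ (rows F) (cols E) o∈FE
    ...   | i∈ , j∈ with ∈-map⁻ row i∈ | ∈-map⁻ col j∈
    ...     | t , t∈ , refl | s , s∈ , refl = via s∈ t∈ (crossing-unoccupied {s} {t} (inj₂ unocc))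

  -- Two 1-edges are excluded because their orthogonality is itself derived from this lemma.
  -- Rigidity is asked only of the 2-edges through `c` or `d`, so that the lemma can serve inside
  -- the induction of `twoEdges-rigid`.
  separated⇒⟂ : ∀ {c d} → ¬ Together G c d → ¬ (c ∈ E₁ × d ∈ E₁) →
                (∀ {e} → e ∈ E₂ → IsHalf c e ⊎ IsHalf d e → Rigid (two e)) →
                ⟨ v c , v d ⟩ ≈ 0#
  separated⇒⟂ {c} {d} apart ¬ones rigid with occupied? G c | occupied? G d
  ... | no c-unocc | _          = unoccupied⇒⟂ (inj₁ c-unocc)
  ... | yes _      | no d-unocc = unoccupied⇒⟂ (inj₂ d-unocc)
  ... | yes (inj₁ c∈) | yes (inj₁ d∈) = contradiction (c∈ , d∈) ¬ones
  ... | yes (inj₁ c∈) | yes (inj₂ (f , f∈ , d∈f)) =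
    rigid⇒⟂ (one c∈) (two f∈) (λ ()) (inj₂ (two f)) (rigid-one c) (rigid f∈ (inj₂ d∈f)) (here refl) (IsHalf⇒∈ f d∈f)
  ... | yes (inj₂ (e , e∈ , c∈e)) | yes (inj₁ d∈) =
    rigid⇒⟂ (two e∈) (one d∈) (λ ()) (inj₁ (two e)) (rigid e∈ (inj₁ c∈e)) (rigid-one d) (IsHalf⇒∈ e c∈e) (here refl)
  ... | yes (inj₂ (e , e∈ , c∈e)) | yes (inj₂ (f , f∈ , d∈f)) =
    rigid⇒⟂ (two e∈) (two f∈) (λ { refl → apart (two e , two e∈ , IsHalf⇒∈ e c∈e , IsHalf⇒∈ e d∈f) })
      (inj₁ (two e)) (rigid e∈ (inj₁ c∈e)) (rigid f∈ (inj₂ d∈f)) (IsHalf⇒∈ e c∈e) (IsHalf⇒∈ f d∈f)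

  -- Induction along proper arcs. The main case has both opposite cells occupied, by different
  -- edges: (W2′) rules out two 1-edges, and a nondegenerate 2-edge through either cell is a
  -- successor of `e`, hence rigid by induction. So the opposite cells are orthogonal, and
  -- `crossing` gives the halves inner product 1.
  twoEdges-rigid : ∀ e → e ∈ E₂ → Rigid (two e)
  twoEdges-rigid e = go e (ProperArc-wellFounded G condW2 e)
    where
    go : ∀ e → Acc (flip (ProperArc G)) e → e ∈ E₂ → Rigid (two e)
    go e (acc rs) e∈ with nondegenerate? G e
    ... | no deg = degenerate⇒rigid e∈ deg
    ... | yes nd = case-opp (occupied? G (opp₁ e)) (occupied? G (opp₂ e))
      where
      case-opp : Dec (Occupied G (opp₁ e)) → Dec (Occupied G (opp₂ e)) → Rigid (two e)
      case-opp (no unocc) _          = ⟨halves⟩⇒rigid e∈ (crossing-unoccupied {half₁ e} {half₂ e} (inj₁ unocc))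
      case-opp (yes _)    (no unocc) = ⟨halves⟩⇒rigid e∈ (crossing-unoccupied {half₁ e} {half₂ e} (inj₂ unocc))
      case-opp (yes o₁)   (yes o₂)   with occupied⇒covered G o₁
      ... | E , isE , o₁∈E with opp₂ e ∈? cells E
      ... | yes o₂∈E = complemented⇒rigid e∈ (E , isE , o₁∈E , o₂∈E)
      ... | no o₂∉E = ⟨halves⟩⇒rigid e∈ (crossing-⟂ {half₁ e} {half₂ e} apart (separated⇒⟂ apart (condW2′ e∈ nd) successor))
        where
        apart : ¬ Together G (opp₁ e) (opp₂ e)
        apart (F , isF , o₁∈F , o₂∈F) = o₂∉E (≡.subst (λ H → opp₂ e ∈ cells H)
          (edge-of-cell-unique G condS isF isE o₁∈F o₁∈E) o₂∈F)
        -- Arcs join distinct 2-edges; since `e` is nondegenerate, its opposite cells are not among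
        -- its halves.
        opposite≢half : ∀ {f} → IsHalf (opp₁ e) f ⊎ IsHalf (opp₂ e) f → e ≢ f
        opposite≢half (inj₁ (inj₁ eq)) refl = proj₂ nd (cong col (≡.sym eq))
        opposite≢half (inj₁ (inj₂ eq)) refl = proj₁ nd (cong row eq)
        opposite≢half (inj₂ (inj₁ eq)) refl = proj₁ nd (cong row (≡.sym eq))
        opposite≢half (inj₂ (inj₂ eq)) refl = proj₂ nd (cong col eq)
        successor : ∀ {f} → f ∈ E₂ → IsHalf (opp₁ e) f ⊎ IsHalf (opp₂ e) f → Rigid (two f)
        successor {f} f∈ half with nondegenerate? G f
        -- Degenerate 2-edges are not vertices of the dependency graph and are settled without
        -- recursion.
        ... | no deg = degenerate⇒rigid f∈ deg
        ... | yes ndf = go f (rs (((e∈ , nd) , (f∈ , ndf) , opposite≢half half , o₁ , o₂ , half)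
                -- The arc is proper: a complement of `e` would contain both opposite cells,
                -- contrary to `apart`.
                , λ { (g , g∈ , h₁ , h₂) → apart (two g , two g∈ , IsHalf⇒∈ g h₁ , IsHalf⇒∈ g h₂) })) f∈

  -- For cells on no common line, (W1) keeps the crossing cells from both being 1-edges. All 2-edges
  -- are known to be rigid by now, so `separated⇒⟂` applies to the crossing pair.
  oneEdges-⟂ : ∀ {c d} → c ∈ E₁ → d ∈ E₁ → c ≢ d → ⟨ v c , v d ⟩ ≈ 0#
  oneEdges-⟂ {c} {d} c∈ d∈ c≢d = trans equal (apart⇒⟨w,w⟩≈0
      (¬together G condS (one c∈) (one d∈) (λ { refl → c≢d refl }) (here refl) (here refl)))
    where
    equal : ⟨ v c , v d ⟩ ≈ ⟨ w c , w d ⟩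
    equal with row c Fin.≟ row d | col c Fin.≟ col d
    ... | yes eq | _      = collinear c d (inj₁ eq)
    ... | no _   | yes eq = collinear c d (inj₂ eq)
    ... | no r≢  | no c≢  = crossing-⟂ {c} {d} apart
      (separated⇒⟂ apart (λ { (o₁ , o₂) → condW1 r≢ c≢ (c∈ , o₁ , o₂ , d∈) })
        λ {e} e∈ _ → twoEdges-rigid e e∈)
      where
      -- A 2-edge with the crossing cells as halves would have the 1-edges `c` and `d` as its
      -- opposite cells, against (W2′).
      apart : ¬ Together G (cross c d) (cross d c)
      apart (_ , one _ , here refl , here eq) = r≢ (cong row (≡.sym eq))
      apart (_ , two {e} e∈ , here refl , here eq) = r≢ (cong row (≡.sym eq))
      apart (_ , two {e} e∈ , here refl , there (here refl)) = condW2′ e∈ (r≢ , c≢ ∘ ≡.sym) (c∈ , d∈)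
      apart (_ , two {e} e∈ , there (here refl) , here refl) = condW2′ e∈ (r≢ ∘ ≡.sym , c≢) (d∈ , c∈)
      apart (_ , two {e} e∈ , there (here refl) , there (here eq)) = r≢ (cong row (≡.sym eq))

  rigid : ∀ {E} → IsEdge G E → Rigid E
  rigid (one {c} _)  = rigid-one c
  rigid (two {e} e∈) = twoEdges-rigid e e∈

  representative : Edge {m} {n} → Cell m n
  representative (one c) = c
  representative (two e) = half₁ e

  representative∈cells : ∀ E → representative E ∈ cells E
  representative∈cells (one c) = here refl
  representative∈cells (two e) = here refl

  distinct-edges-⟂ : ∀ {E F} → IsEdge G E → IsEdge G F → E ≢ F →
                     ⟨ v (representative E) , v (representative F) ⟩ ≈ 0#
  distinct-edges-⟂ (one c∈) (one d∈) E≢F = oneEdges-⟂ c∈ d∈ λ { refl → E≢F refl }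
  distinct-edges-⟂ {E} {F} isE (two f∈) E≢F = rigid⇒⟂ isE (two f∈) E≢F (inj₂ (two _))
    (rigid isE) (rigid (two f∈)) (representative∈cells E) (representative∈cells F)
  distinct-edges-⟂ {E} {F} (two e∈) isF@(one _) E≢F = rigid⇒⟂ (two e∈) isF E≢F (inj₁ (two _))
    (rigid (two e∈)) (rigid isF) (representative∈cells E) (representative∈cells F)

  edgeVectors : Fin (length (edges G)) → Vector l
  edgeVectors p = v (representative (lookup (edges G) p))

  edgeVectors-orthonormal : Orthonormal edgeVectors
  edgeVectors-orthonormal p q with p Fin.≟ q
  ... | yes refl = trans
    (v-occupied (covered⇒occupied G (∈⇒IsEdge G (∈-lookup p)) (representative∈cells _))) (sym (δ-refl p))
  ... | no p≢q = trans
    (distinct-edges-⟂ (∈⇒IsEdge G (∈-lookup p)) (∈⇒IsEdge G (∈-lookup q))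
      (p≢q ∘ Unique⇒lookup-injective (edges-unique G) p q))
    (sym (δ-≢ p≢q))

  edges≤squares : ¬ 1# ≈ 0# → length (edges G) ≤ l
  edges≤squares 1≉0 = orthonormal⇒≤ 1≉0 edgeVectors edgeVectors-orthonormal

-- The real numbers as a formally real commutative ring.

open Defs using (_≈_; mk≈)

-- `x ≈ y` amounts to this property of the termwise difference, so congruence proofs reduce to
-- closure properties of null sequences.
Null : (ℕ → ℚ) → Set
Null a = ∀ ε → 0ℚ ℚ.< ε → ∃[ N ] ∀ i → N ℕ.≤ i → ∣ a i ∣ ℚ.< ε

private
  half>0 : ∀ {ε} → 0ℚ ℚ.< ε → 0ℚ ℚ.< ½ ℚ.* ε
  half>0 {ε} ε>0 = ≡.subst (ℚ._< ½ ℚ.* ε) (ℚ.*-zeroʳ ½) (ℚ.*-monoʳ-<-pos ½ ε>0)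

  half+half : ∀ ε → ½ ℚ.* ε ℚ.+ ½ ℚ.* ε ≡ ε
  half+half ε = ≡.trans (≡.sym (ℚ.*-distribʳ-+ ε ½ ½)) (ℚ.*-identityˡ ε)

Null-resp-≗ : ∀ {a b} → Null a → a ≗ b → Null b
Null-resp-≗ na a≗b ε ε>0 with na ε ε>0
... | N , h = N , λ i N≤i → ≡.subst (λ t → ∣ t ∣ ℚ.< ε) (a≗b i) (h i N≤i)

Null-0 : Null (λ _ → 0ℚ)
Null-0 ε ε>0 = 0 , λ _ _ → ε>0

Null-+ : ∀ {a b} → Null a → Null b → Null (λ i → a i ℚ.+ b i)
Null-+ {a} {b} na nb ε ε>0 with na (½ ℚ.* ε) (half>0 ε>0) | nb (½ ℚ.* ε) (half>0 ε>0)
... | M , f | N , g = M ℕ.⊔ N , λ i i≥ →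
  ℚ.≤-<-trans (ℚ.∣p+q∣≤∣p∣+∣q∣ (a i) (b i))
    (≡.subst (∣ a i ∣ ℚ.+ ∣ b i ∣ ℚ.<_) (half+half ε)
      (ℚ.+-mono-< (f i (ℕ.m⊔n≤o⇒m≤o M N i≥)) (g i (ℕ.m⊔n≤o⇒n≤o M N i≥))))

Null-neg : ∀ {a} → Null a → Null (λ i → ℚ.- a i)
Null-neg {a} na ε ε>0 with na ε ε>0
... | N , h = N , λ i N≤i → ≡.subst (ℚ._< ε) (≡.sym (ℚ.∣-p∣≡∣p∣ (a i))) (h i N≤i)

cauchy⇒bounded : ∀ {x} → IsCauchy x →
                 ∃[ B ] ∃[ N ] Positive B × (∀ i → N ℕ.≤ i → ∣ x i ∣ ℚ.≤ B)
cauchy⇒bounded {x} cx with cx 1ℚ (ℚ.positive⁻¹ 1ℚ)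
... | N , h = 1ℚ ℚ.+ ∣ x N ∣ , N
            , ℚ.positive (ℚ.+-mono-<-≤ (ℚ.positive⁻¹ 1ℚ) (ℚ.0≤∣p∣ (x N)))
            , λ i N≤i → begin
    ∣ x i ∣                       ≡⟨ cong ∣_∣ (solve 2 (λ a b →
      a := (a :- b) :+ b) refl (x i) (x N)) ⟩
    ∣ (x i ℚ.- x N) ℚ.+ x N ∣     ≤⟨ ℚ.∣p+q∣≤∣p∣+∣q∣ (x i ℚ.- x N) (x N) ⟩
    dist (x i) (x N) ℚ.+ ∣ x N ∣  ≤⟨ ℚ.+-monoˡ-≤ ∣ x N ∣ (ℚ.<⇒≤ (h i N N≤i ℕ.≤-refl)) ⟩
    1ℚ ℚ.+ ∣ x N ∣                ∎
  where
  open +-*-Solver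
  open ℚ.≤-Reasoning

divide : ∀ B {ε} → Positive B → 0ℚ ℚ.< ε → ∃[ δ ] 0ℚ ℚ.< δ × B ℚ.* δ ≡ ε
divide B {ε} B>0 ε>0 = B⁻¹ ℚ.* ε
  , ≡.subst (ℚ._< B⁻¹ ℚ.* ε) (ℚ.*-zeroʳ B⁻¹) (ℚ.*-monoʳ-<-pos B⁻¹ {{ℚ.1/pos⇒pos B {{B>0}}}} ε>0)
  , ≡.trans (≡.sym (ℚ.*-assoc B B⁻¹ ε))
      (≡.trans (cong (ℚ._* ε) (ℚ.*-inverseʳ B {{ℚ.pos⇒nonZero B {{B>0}}}})) (ℚ.*-identityˡ ε))
  where
  B⁻¹ : ℚ
  B⁻¹ = (1/ B) {{ℚ.pos⇒nonZero B {{B>0}}}}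

bounded*Null : ∀ {x a : ℕ → ℚ} B M → Positive B → (∀ i → M ℕ.≤ i → ∣ x i ∣ ℚ.≤ B) →
               Null a → Null (λ i → x i ℚ.* a i)
bounded*Null {x} {a} B M B>0 bound na ε ε>0 =
  let (δ , δ>0 , Bδ≡ε) = divide B B>0 ε>0
      (N , h) = na δ δ>0
  in M ℕ.⊔ N , λ i i≥ → begin-strict
    ∣ x i ℚ.* a i ∣      ≡⟨ ℚ.∣p*q∣≡∣p∣*∣q∣ (x i) (a i) ⟩
    ∣ x i ∣ ℚ.* ∣ a i ∣  ≤⟨ ℚ.*-monoʳ-≤-nonNeg ∣ a i ∣ {{ℚ.∣-∣-nonNeg (a i)}}
                            (bound i (ℕ.m⊔n≤o⇒m≤o M N i≥)) ⟩
    B ℚ.* ∣ a i ∣        <⟨ ℚ.*-monoʳ-<-pos B {{B>0}} (h i (ℕ.m⊔n≤o⇒n≤o M N i≥)) ⟩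
    B ℚ.* δ              ≡⟨ Bδ≡ε ⟩
    ε                    ∎
  where open ℚ.≤-Reasoning

cauchy*Null : ∀ {x a} → IsCauchy x → Null a → Null (λ i → x i ℚ.* a i)
cauchy*Null {x} {a} cx na =
  let (B , M , B>0 , bound) = cauchy⇒bounded {x} cx in bounded*Null {x} {a} B M B>0 bound na

1ℝ : ℝ
1ℝ = fromℚ 1ℚ

-- As multiplication by -1, negation inherits its Cauchy proof from `_*ℝ_`.
-ℝ_ : ℝ → ℝ
-ℝ x = fromℚ (ℚ.- 1ℚ) *ℝ x

Null⇒≈ : ∀ {x y} → Null (λ i → seq x i ℚ.- seq y i) → x ≈ y
Null⇒≈ = mk≈

≈⇒Null : ∀ {x y} → x ≈ y → Null (λ i → seq x i ℚ.- seq y i)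
≈⇒Null = _≈_.difference→0

-- All operations act termwise, so this carries the ring laws over from `ℚ`.
termwise⇒≈ : ∀ {x y} → seq x ≗ seq y → x ≈ y
termwise⇒≈ {x} {y} x≗y = Null⇒≈ (Null-resp-≗ Null-0
  λ i → ≡.sym (≡.trans (cong (ℚ._- seq y i) (x≗y i)) (ℚ.+-inverseʳ (seq y i))))

≈-refl : ∀ {x} → x ≈ x
≈-refl = termwise⇒≈ λ _ → refl

≈-sym : ∀ {x y} → x ≈ y → y ≈ x
≈-sym {x} {y} x≈y = Null⇒≈ (Null-resp-≗ (Null-neg (≈⇒Null x≈y))
  λ i → solve 2 (λ a b → :- (a :- b) := b :- a) refl (seq x i) (seq y i))
  where open +-*-Solver

≈-trans : ∀ {x y z} → x ≈ y → y ≈ z → x ≈ z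
≈-trans {x} {y} {z} x≈y y≈z = Null⇒≈ (Null-resp-≗ (Null-+ (≈⇒Null x≈y) (≈⇒Null y≈z))
  λ i → solve 3 (λ a b c → (a :- b) :+ (b :- c) := a :- c) refl (seq x i) (seq y i) (seq z i))
  where open +-*-Solver

+ℝ-cong : ∀ {x y u v} → x ≈ y → u ≈ v → x +ℝ u ≈ y +ℝ v
+ℝ-cong {x} {y} {u} {v} x≈y u≈v = Null⇒≈ (Null-resp-≗ (Null-+ (≈⇒Null x≈y) (≈⇒Null u≈v))
  λ i → solve 4 (λ a b c d → (a :- b) :+ (c :- d) := (a :+ c) :- (b :+ d)) refl
          (seq x i) (seq y i) (seq u i) (seq v i))
  where open +-*-Solver

-- The difference of the products is `x (u - v) + v (x - y)`, and a Cauchy sequence, being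
-- eventually bounded, preserves null sequences under multiplication.
*ℝ-cong : ∀ {x y u v} → x ≈ y → u ≈ v → x *ℝ u ≈ y *ℝ v
*ℝ-cong {x} {y} {u} {v} x≈y u≈v = Null⇒≈ (Null-resp-≗
  (Null-+ (cauchy*Null {seq x} (cauchy x) (≈⇒Null u≈v))
          (cauchy*Null {seq v} (cauchy v) (≈⇒Null x≈y)))
  λ i → solve 4 (λ a b c d → a :* (c :- d) :+ d :* (a :- b) := a :* c :- b :* d) refl
          (seq x i) (seq y i) (seq u i) (seq v i))
  where open +-*-Solver

ℝ-commutativeRing : CommutativeRing 0ℓ 0ℓ
ℝ-commutativeRing = record
  { Carrier = ℝ
  ; _≈_     = _≈_
  ; _+_     = _+ℝ_
  ; _*_     = _*ℝ_
  ; -_      = -ℝ_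
  ; 0#      = 0ℝ
  ; 1#      = 1ℝ
  ; isCommutativeRing = record
    { isRing = record
      { +-isAbelianGroup = record
        { isGroup = record
          { isMonoid = record
            { isSemigroup = record
              { isMagma = record
                { isEquivalence = record { refl = ≈-refl ; sym = ≈-sym ; trans = ≈-trans }
                ; ∙-cong        = +ℝ-cong
                }
              ; assoc = λ x y z → termwise⇒≈ λ i → ℚ.+-assoc (seq x i) (seq y i) (seq z i)
              }
            ; identity = (λ x → termwise⇒≈ λ i → ℚ.+-identityˡ (seq x i))
                       , (λ x → termwise⇒≈ λ i → ℚ.+-identityʳ (seq x i))
            }
          ; inverse = (λ x → termwise⇒≈ λ i → solve 1 (λ a → con (ℚ.- 1ℚ) :* a :+ a := con 0ℚ) refl (seq x i))
                    , (λ x → termwise⇒≈ λ i → solve 1 (λ a → a :+ con (ℚ.- 1ℚ) :* a := con 0ℚ) refl (seq x i))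
          ; ⁻¹-cong = *ℝ-cong ≈-refl
          }
        ; comm = λ x y → termwise⇒≈ λ i → ℚ.+-comm (seq x i) (seq y i)
        }
      ; *-cong     = *ℝ-cong
      ; *-assoc    = λ x y z → termwise⇒≈ λ i → ℚ.*-assoc (seq x i) (seq y i) (seq z i)
      ; *-identity = (λ x → termwise⇒≈ λ i → ℚ.*-identityˡ (seq x i))
                   , (λ x → termwise⇒≈ λ i → ℚ.*-identityʳ (seq x i))
      ; distrib    = (λ x y z → termwise⇒≈ λ i → ℚ.*-distribˡ-+ (seq x i) (seq y i) (seq z i))
                   , (λ x y z → termwise⇒≈ λ i → ℚ.*-distribʳ-+ (seq x i) (seq y i) (seq z i))
      }
    ; *-comm = λ x y → termwise⇒≈ λ i → ℚ.*-comm (seq x i) (seq y i)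
    }
  }
  where open +-*-Solver

½+½≈1 : fromℚ ½ +ℝ fromℚ ½ ≈ 1ℝ
½+½≈1 = termwise⇒≈ λ _ → refl

1≉0 : ¬ 1ℝ ≈ 0ℝ
1≉0 1≈0 with ≈⇒Null 1≈0 1ℚ (ℚ.positive⁻¹ 1ℚ)
... | N , h = ℚ.<-irrefl refl (h N ℕ.≤-refl)

private
  ∣p∣²≡p² : ∀ p → ∣ p ∣ ℚ.* ∣ p ∣ ≡ p ℚ.* p
  ∣p∣²≡p² p with ℚ.∣p∣≡p∨∣p∣≡-p p
  ... | inj₁ eq = cong₂ ℚ._*_ eq eq
  ... | inj₂ eq = ≡.trans (cong₂ ℚ._*_ eq eq) (solve 1 (λ a → :- a :* :- a := a :* a) refl p)
    where open +-*-Solver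

  square-mono-≤ : ∀ {p q} → 0ℚ ℚ.≤ p → p ℚ.≤ q → p ℚ.* p ℚ.≤ q ℚ.* q
  square-mono-≤ {p} {q} 0≤p p≤q = ℚ.≤-trans
    (ℚ.*-monoˡ-≤-nonNeg p {{ℚ.nonNegative 0≤p}} p≤q)
    (ℚ.*-monoʳ-≤-nonNeg q {{ℚ.nonNegative (ℚ.≤-trans 0≤p p≤q)}} p≤q)

  square≥0 : ∀ p → 0ℚ ℚ.≤ p ℚ.* p
  square≥0 p = ≡.subst (0ℚ ℚ.≤_) (∣p∣²≡p² p) (square-mono-≤ ℚ.≤-refl (ℚ.0≤∣p∣ p))

-- The index of `SumOfSquares` is a literal expression and not a class up to `_≈_`, so the bound
-- holds at every index and not only in the limit.
sumOfSquares≥0 : ∀ {s} → BilinearAlgebra.SumOfSquares ℝ-commutativeRing s → ∀ i → 0ℚ ℚ.≤ seq s i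
sumOfSquares≥0 BilinearAlgebra.none         i = ℚ.≤-refl
sumOfSquares≥0 (BilinearAlgebra.square x)   i = square≥0 (seq x i)
sumOfSquares≥0 (p BilinearAlgebra.⊕ q)      i = ℚ.+-mono-≤ (sumOfSquares≥0 p i) (sumOfSquares≥0 q i)

-- For the tolerance `ε`, the hypothesis is used at `ε * ε`: an index with `ε ≤ ∣ seq x i ∣` would
-- violate it, since `seq s i` is non-negative and cannot compensate the square.
ℝ-formallyReal : BilinearAlgebra.FormallyReal ℝ-commutativeRing
ℝ-formallyReal {x} {s} sos x²+s≈0 = Null⇒≈ (Null-resp-≗ null λ i → ≡.sym (ℚ.+-identityʳ (seq x i)))
  where
  null : Null (seq x)
  null ε ε>0 with ≈⇒Null x²+s≈0 (ε ℚ.* ε) (ℚ.positive⁻¹ (ε ℚ.* ε) {{ℚ.pos*pos⇒pos ε {{ε⁺}} ε {{ε⁺}}}})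
    where ε⁺ = ℚ.positive ε>0
  ... | N , h = N , λ i N≤i → ℚ.≰⇒> λ ε≤∣x∣ → ℚ.<-irrefl refl (begin-strict
    ε ℚ.* ε                                       ≤⟨ square-mono-≤ (ℚ.<⇒≤ ε>0) ε≤∣x∣ ⟩
    ∣ seq x i ∣ ℚ.* ∣ seq x i ∣                   ≡⟨ ∣p∣²≡p² (seq x i) ⟩
    seq x i ℚ.* seq x i                           ≡⟨ ℚ.+-identityʳ _ ⟨
    seq x i ℚ.* seq x i ℚ.+ 0ℚ                    ≤⟨ ℚ.+-monoʳ-≤ (seq x i ℚ.* seq x i) (sumOfSquares≥0 sos i) ⟩
    seq x i ℚ.* seq x i ℚ.+ seq s i               ≡⟨ ℚ.0≤p⇒∣p∣≡p (ℚ.+-mono-≤ (square≥0 (seq x i)) (sumOfSquares≥0 sos i)) ⟨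
    ∣ seq x i ℚ.* seq x i ℚ.+ seq s i ∣           ≡⟨ cong ∣_∣ (ℚ.+-identityʳ _) ⟨
    ∣ seq x i ℚ.* seq x i ℚ.+ seq s i ℚ.- 0ℚ ∣    <⟨ h i N≤i ⟩
    ε ℚ.* ε                                       ∎)
    where open ℚ.≤-Reasoning

-- The chain of inequalities.

module _ {m n : ℕ} (G : AugmentedGraph m n) where
  open BilinearAlgebra ℝ-commutativeRing
  open GraphForms ℝ-commutativeRing G

  graphForm : BiquadraticForm m n
  graphForm = record
    { coeff = coefficient (fromℚ ½) edgeForms
    ; sym₁  = coefficient-sym₁ (fromℚ ½) edgeForms
    ; sym₂  = coefficient-sym₂ (fromℚ ½) edgeForms
    }

  graphForm≈squares : ∀ x y → evalBiquadratic graphForm x y ≈ sumOfSquares edgeForms x y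
  graphForm≈squares = expand-squares ½+½≈1 edgeForms

  -- The edge forms themselves attain the rank. Any other representation takes the same values as
  -- theirs, so `edges≤squares` bounds its number of squares from below.
  graphForm-rank : WeaklyAdmissible G → IsSOSRank graphForm (length (edges G))
  graphForm-rank admissible = (edgeForms , graphForm≈squares) , λ l (f , P≈f) →
    Representation.edges≤squares ℝ-commutativeRing ℝ-formallyReal G admissible f
      (λ x y → ≈-trans (≈-sym (P≈f x y)) (graphForm≈squares x y)) 1≉0

bsr≥zwA : ∀ {m n bsr zwA} → IsBSR m n bsr → IsZwA m n zwA → bsr ≥ zwA
bsr≥zwA {bsr = bsr} (_ , maximal) ((G , admissible , refl) , _) =
  ≡.subst (_≤ bsr) (length-edges G)
    (maximal (length (edges G)) (graphForm G , graphForm-rank G admissible))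

zwA≥zwL : ∀ {m n zwA zwL} → IsZwA m n zwA → IsZwL m n zwL → zwA ≥ zwL
zwA≥zwL (_ , maximal) ((G , admissible , _ , size≡) , _) = maximal _ (G , admissible , size≡)

zwL≥zL : ∀ {m n zwL zL} → IsZwL m n zwL → IsZL m n zL → zwL ≥ zL
zwL≥zL (_ , maximal) ((G , condS , condW1 , cond2 , cond3 , limited , size≡) , _) = maximal _
  (G , (condS , condW1 , cond2⇒W2 G cond2 , cond2⇒W2′ G cond2 , cond3⇒W3 G cond3) , limited , size≡)

-- An extremal `C₄`-free graph without 2-edges satisfies (S) and Conditions 2 and 3 vacuously.
zL≥z : ∀ {m n zL z} → IsZL m n zL → IsZarankiewicz m n z → zL ≥ z
zL≥z {m} {n} (_ , maximal) zarankiewicz@((E , unique , C₄-free , refl) , _) = maximal (length E)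
  (graph , ((λ ()) , λ ()) , C₄-free , (λ ()) , (λ ()) , zarankiewicz , ℕ.+-identityʳ (length E))
  where
  graph : AugmentedGraph m n
  graph = record { E₁ = E ; E₂ = [] ; E₁-unique = unique ; E₂-unique = [] }

theorem10 : (m n : ℕ) → 2 ≤ m → 2 ≤ n →
    (bsr zwA zwL zL z : ℕ) →
    IsBSR m n bsr → IsZwA m n zwA → IsZwL m n zwL → IsZL m n zL → IsZarankiewicz m n z →
    bsr ≥ zwA × zwA ≥ zwL × zwL ≥ zL × zL ≥ z
theorem10 m n _ _ _ _ _ _ _ isBSR isZwA isZwL isZL isZ =
  bsr≥zwA isBSR isZwA , zwA≥zwL isZwA isZwL , zwL≥zL isZwL isZL , zL≥z isZL isZ
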